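{- The numbers of parking functions of $1,\ldots,n$ for which the third, fourth, and fifth spots, respectively, are lucky are given by \begin{align*} \sum_{i=1}^nq_n(i,3)&=\tfrac23(n+1)^{n-1}-\tfrac13(2n-1)(n-2)^{n-2} &&\text{for } n\ge 3,\\ \sum_{i=1}^nq_n(i,4)&=\tfrac58(n+1)^{n-1}-\tfrac18(13n^2-26n+9)(n-3)^{n-3} &&\text{for } n\ge 4,\\ \sum_{i=1}^nq_n(i,5)&=\tfrac35(n+1)^{n-1}-\tfrac1{30}(118n^3-531n^2+659n-192)(n-4)^{n-4} &&\text{for } n\ge 5. \end{align*}
   Context: There are $n$ spots labeled $1,\ldots,n$ in order along a one-way street, and $n$ cars entering one after another, car $i$ having preference $a_i\in\{1,\ldots,n\}$. Each car drives to its preferred spot and parks there if it is available; otherwise it moves forward and parks in the first available later spot, if any (if none, it fails to park). A parking function of $1,\ldots,n$ is a sequence of preferences $(a_1,\ldots,a_n)$ such that all $n$ cars are able to park. A car is lucky if it parks in its preferred spot; a spot is lucky if the car that parks in it prefers that spot. For $1\le i,j\le n$, $q_n(i,j)$ denotes the number of parking functions of $1,\ldots,n$ in which the $i$-th car prefers the $j$-th spot and the $i$-th car is lucky. -}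

module Defs where

open import Data.Fin using (Fin)
open import Data.Fin.Properties using (_≟_; _≤?_; all?; any?)
open import Data.Fin.Subset using (Subset; _∪_; ⁅_⁆; ⊥)
open import Data.Fin.Subset.Properties using (_∈?_)
open import Data.Integer using (+_)
open import Data.List using (List; []; _∷_; [_]; allFin; cartesianProductWith; filter; find; length; map)
open import Data.Maybe using (Maybe; just; maybe′)
open import Data.Maybe.Properties using (≡-dec)
open import Data.Nat using (ℕ; zero; suc)
open import Data.Nat.ListAction using (sum)
open import Data.Product using (∃; _×_)
open import Data.Rational using (ℚ)
open import Data.Rational.Literals using (fromℤ)
open import Data.Vec using (Vec; []; _∷_; lookup)
open import Relation.Binary.PropositionalEquality using (_≡_)
open import Relation.Nullary using (Dec; ¬?)
open import Relation.Nullary.Decidable using (_×-dec_)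

-- Cars and spots 1, …, n are represented by Fin n, so the spot labelled k is
-- the element s with toℕ s ≡ k - 1.  A preference sequence is a : Vec (Fin n) n.

-- The spot taken by a car with preference p when the spots in occ are
-- occupied: allFin n is increasing, so this is p itself if p is available and
-- otherwise the first available spot after p; nothing if there is none.
firstAvailable : ∀ {n} → Subset n → Fin n → Maybe (Fin n)
firstAvailable {n} occ p = find (λ s → (p ≤? s) ×-dec ¬? (s ∈? occ)) (allFin n)

-- A car that fails to park leaves the set of occupied spots unchanged.
parkFrom : ∀ {n m} → Subset n → Vec (Fin n) m → Vec (Maybe (Fin n)) m
parkFrom occ []       = []
parkFrom occ (p ∷ ps) =
  let s = firstAvailable occ p
  in  s ∷ parkFrom (maybe′ (λ t → occ ∪ ⁅ t ⁆) occ s) ps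

outcome : ∀ {n} → Vec (Fin n) n → Vec (Maybe (Fin n)) n
outcome = parkFrom ⊥

module _ {n : ℕ} (a : Vec (Fin n) n) where

  Prefers : Fin n → Fin n → Set
  Prefers i s = lookup a i ≡ s

  ParksIn : Fin n → Fin n → Set
  ParksIn i s = lookup (outcome a) i ≡ just s

  IsParkingFunction : Set
  IsParkingFunction = ∀ i → ∃ λ s → ParksIn i s

  LuckyCar : Fin n → Set
  LuckyCar i = ParksIn i (lookup a i)

  LuckySpot : Fin n → Set
  LuckySpot s = ∃ λ i → ParksIn i s × Prefers i s

  prefers? : ∀ i s → Dec (Prefers i s)
  prefers? i s = lookup a i ≟ s

  parksIn? : ∀ i s → Dec (ParksIn i s)
  parksIn? i s = ≡-dec _≟_ (lookup (outcome a) i) (just s)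

  isParkingFunction? : Dec IsParkingFunction
  isParkingFunction? = all? λ i → any? λ s → parksIn? i s

  luckyCar? : ∀ i → Dec (LuckyCar i)
  luckyCar? i = parksIn? i (lookup a i)

  luckySpot? : ∀ s → Dec (LuckySpot s)
  luckySpot? s = any? λ i → parksIn? i s ×-dec prefers? i s

-- Every vector of Vec (Fin n) m occurs exactly once.
allVecs : ∀ n m → List (Vec (Fin n) m)
allVecs n zero    = [ [] ]
allVecs n (suc m) = cartesianProductWith _∷_ (allFin n) (allVecs n m)

parkingFunctions : ∀ n → List (Vec (Fin n) n)
parkingFunctions n = filter isParkingFunction? (allVecs n n)

q : ∀ n → Fin n → Fin n → ℕ
q n i j = length (filter (λ a → prefers? a i j ×-dec luckyCar? a i) (parkingFunctions n))

sumOfQ : ∀ n → Fin n → ℕ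
sumOfQ n j = sum (map (λ i → q n i j) (allFin n))

luckySpotCount : ∀ n → Fin n → ℕ
luckySpotCount n j = length (filter (λ a → luckySpot? a j) (parkingFunctions n))

ι : ℕ → ℚ
ι n = fromℤ (+ n)

{-# OPTIONS --safe #-}

-- Let the lucky spot be k + 1, and let b = n - k.  Luckiness of that spot depends only on the
-- subword of preferences ≤ k + 1, say of length s; the other n - s cars then complete a
-- parking function in (s - k) b^(n-s-1) ways.  Since the weight s - k may be truncated to 0
-- for s < k, it remains to count words of length s > k over k + 1 letters which make spot
-- k + 1 lucky and fill the spots before it.  Dropping the last condition, the number is
-- h (k + 1)^(s-k-1) with h constant, because the fate of spot k + 1 is decided within
-- k + 1 cars; the words with a first gap at spot e + 1 split into a parking function of
-- length e and such a word for k - e - 1.  Hence everything reduces to the sums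
-- Σ_s (m choose s) a^s b^(m-s) (s ∸ j), and s ∸ j = (s - j) + (j ∸ s) turns these into the
-- binomial theorem plus finitely many terms.  The words with a gap have a = j and m = a + b,
-- and for them the binomial part Σ_s (m choose s) a^s b^(m-s) (s - j) vanishes.

module Submission where

open import Defs

-- The obstacle that shapes the proof is that luckiness depends on the order in which the cars
-- arrive, whereas the set of filled spots does not. Hence the same street is modelled twice: `park`
-- and `lucky` follow the cars one by one through an occupancy vector, while `fits`, `full` and
-- `firstGap` scan the spots from left to right and use only how many cars want each of them;
-- `fitsFrom` mediates between the two models. The factor (s - k) b^(n-s-1) counts the completions
-- when s - k - 1 cars have been pushed past the lucky spot onto the b - 1 spots behind it; it
-- generalises the number of parking functions and is proved by induction on the number of spots.
-- The constant h is not derived but computed: for k = 0, ..., 4 it is 1, 3, 18, 160, 1875, found by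
-- running through all (k+1)^(k+1) words. The numbers 1, 1, 3, 16 of parking functions before a gap
-- are evaluated in the same way. All counting stays in ℕ: identities are multiplied by their
-- denominators, and negative terms are moved to the other side. ℚ enters only when the final
-- formulas are stated.

module Counting where

  open import Data.Bool using (Bool; true; false; if_then_else_)
  open import Data.Bool.Properties using (∨-identityʳ; ∨-zeroʳ)
  open import Data.Empty using (⊥-elim)
  open import Data.Fin as Fin using (Fin; toℕ; _↑ˡ_; _↑ʳ_)
  open import Data.Fin.Properties as Fin using (toℕ-injective; toℕ-↑ʳ; ↑ʳ-injective)
  open import Data.Fin.Subset as Subset using (Subset; _∪_; ⁅_⁆; _∈_)
  open import Data.Fin.Subset.Properties using (_∈?_; ∪-identityʳ; drop-there)
  open import Data.List as List using (List; []; _∷_; length; allFin; filter; find; cartesianProductWith)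
  open import Data.List.Properties using (map-tabulate; map-++; map-cong; map-∘)
  open import Data.Maybe as Maybe using (Maybe; just; nothing; maybe′)
  open import Data.Maybe.Properties as Maybe using (just-injective)
  open import Data.Nat
  open import Data.Nat.Combinatorics using (_C_; nC1≡n; nCn≡1; nCk+nC[k+1]≡[n+1]C[k+1])
  open import Data.Nat.ListAction using (sum)
  open import Data.Nat.ListAction.Properties using (sum-++)
  open import Data.Nat.Properties
  open import Data.Nat.Tactic.RingSolver using (solve-∀)
  open import Data.Product using (∃; _×_; _,_)
  open import Data.Sum using (_⊎_; inj₁; inj₂; [_,_]′; map₁)
  open import Data.Vec using (Vec; []; _∷_; _++_; lookup; replicate; _[_]≔_; there)
  open import Data.Vec.Properties using ([]≔-++-↑ˡ; []≔-++-↑ʳ; lookup∘updateAt)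
  open import Function using (_∘_; const; case_of_; _⇔_; mk⇔)
  open import Relation.Binary.PropositionalEquality
  open import Relation.Nullary using (Dec; yes; no; does; ¬_; ¬?)
  open import Relation.Nullary.Decidable using (does-⇔; _×-dec_)
  open import Relation.Unary using (Decidable)
  open ≡-Reasoning

  -- Sums over words

  +-interchange : ∀ a b c d → a + b + (c + d) ≡ a + c + (b + d)
  +-interchange = solve-∀

  Σ< : ℕ → (ℕ → ℕ) → ℕ
  Σ< zero    f = 0
  Σ< (suc n) f = f 0 + Σ< n (f ∘ suc)

  Σ<-cong : ∀ n {f g} → (∀ i → i < n → f i ≡ g i) → Σ< n f ≡ Σ< n g
  Σ<-cong zero    h = refl
  Σ<-cong (suc n) h = cong₂ _+_ (h 0 z<s) (Σ<-cong n λ i i<n → h (suc i) (s<s i<n))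

  Σ<-+ : ∀ n f g → Σ< n (λ i → f i + g i) ≡ Σ< n f + Σ< n g
  Σ<-+ zero    f g = refl
  Σ<-+ (suc n) f g rewrite Σ<-+ n (f ∘ suc) (g ∘ suc) =
    +-interchange (f 0) (g 0) (Σ< n (f ∘ suc)) (Σ< n (g ∘ suc))

  Σ<-*ˡ : ∀ c n f → Σ< n (λ i → c * f i) ≡ c * Σ< n f
  Σ<-*ˡ c zero    f = sym (*-zeroʳ c)
  Σ<-*ˡ c (suc n) f rewrite Σ<-*ˡ c n (f ∘ suc) = sym (*-distribˡ-+ c (f 0) _)

  Σ<-const : ∀ n c → Σ< n (const c) ≡ n * c
  Σ<-const zero    c = refl
  Σ<-const (suc n) c = cong (c +_) (Σ<-const n c)

  Σ<-++ : ∀ a b f → Σ< (a + b) f ≡ Σ< a f + Σ< b (f ∘ (a +_))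
  Σ<-++ zero    b f = refl
  Σ<-++ (suc a) b f rewrite Σ<-++ a b (f ∘ suc) = sym (+-assoc (f 0) _ _)

  Σ<-last : ∀ n f → Σ< (suc n) f ≡ Σ< n f + f n
  Σ<-last zero    f = +-identityʳ _
  Σ<-last (suc n) f rewrite Σ<-last n (f ∘ suc) = sym (+-assoc (f 0) _ _)

  -- Bin m F is Σ_{s+t=m} (m choose s) F(s, t).
  Bin : ℕ → (ℕ → ℕ → ℕ) → ℕ
  Bin zero    F = F 0 0
  Bin (suc m) F = Bin m (λ s t → F (suc s) t) + Bin m (λ s t → F s (suc t))

  Bin-cong : ∀ m {F G} → (∀ s t → s + t ≡ m → F s t ≡ G s t) → Bin m F ≡ Bin m G
  Bin-cong zero    h = h 0 0 refl
  Bin-cong (suc m) h = cong₂ _+_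
    (Bin-cong m λ s t eq → h (suc s) t (cong suc eq))
    (Bin-cong m λ s t eq → h s (suc t) (trans (+-suc s t) (cong suc eq)))

  Bin-+ : ∀ m F G → Bin m (λ s t → F s t + G s t) ≡ Bin m F + Bin m G
  Bin-+ zero    F G = refl
  Bin-+ (suc m) F G
    rewrite Bin-+ m (λ s t → F (suc s) t) (λ s t → G (suc s) t)
          | Bin-+ m (λ s t → F s (suc t)) (λ s t → G s (suc t)) =
    +-interchange (Bin m λ s t → F (suc s) t) (Bin m λ s t → G (suc s) t)
                  (Bin m λ s t → F s (suc t)) (Bin m λ s t → G s (suc t))

  Bin-*ˡ : ∀ c m F → Bin m (λ s t → c * F s t) ≡ c * Bin m F
  Bin-*ˡ c zero    F = refl
  Bin-*ˡ c (suc m) F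
    rewrite Bin-*ˡ c m (λ s t → F (suc s) t) | Bin-*ˡ c m (λ s t → F s (suc t)) =
    sym (*-distribˡ-+ c (Bin m (λ s t → F (suc s) t)) (Bin m (λ s t → F s (suc t))))

  Bin-zero : ∀ m {F} → (∀ s t → s + t ≡ m → F s t ≡ 0) → Bin m F ≡ 0
  Bin-zero m h = trans (Bin-cong m h) (Bin-*ˡ 0 m (λ _ _ → 0))

  Bin-Σ< : ∀ m n (F : ℕ → ℕ → ℕ → ℕ) →
           Σ< n (λ i → Bin m (F i)) ≡ Bin m (λ s t → Σ< n (λ i → F i s t))
  Bin-Σ< zero    n F = refl
  Bin-Σ< (suc m) n F =
    trans (Σ<-+ n (λ i → Bin m (λ s t → F i (suc s) t)) (λ i → Bin m (λ s t → F i s (suc t))))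
          (cong₂ _+_ (Bin-Σ< m n λ i s t → F i (suc s) t) (Bin-Σ< m n λ i s t → F i s (suc t)))

  -- Both sides are the trinomial sum over all ways to distribute m positions among three classes of
  -- sizes d, r and t.
  Bin-assoc : ∀ m (F : ℕ → ℕ → ℕ → ℕ) →
              Bin m (λ s t → Bin s (λ d r → F d r t)) ≡ Bin m (λ d q → Bin q (λ r t → F d r t))
  Bin-assoc zero    F = refl
  Bin-assoc (suc m) F = begin
    Bin m (λ s t → Bin s (λ d r → F (suc d) r t) + Bin s (λ d r → F d (suc r) t)) + Z
      ≡⟨ cong (_+ Z) (Bin-+ m (λ s t → Bin s (λ d r → F (suc d) r t)) (λ s t → Bin s (λ d r → F d (suc r) t))) ⟩
    X + Y + Z
      ≡⟨ +-assoc X Y Z ⟩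
    X + (Y + Z)
      ≡⟨ cong₂ _+_ (Bin-assoc m (λ d r t → F (suc d) r t))
           (cong₂ _+_ (Bin-assoc m (λ d r t → F d (suc r) t)) (Bin-assoc m (λ d r t → F d r (suc t)))) ⟩
    Bin m (λ d q → Bin q (λ r t → F (suc d) r t)) +
      (Bin m (λ d q → Bin q (λ r t → F d (suc r) t)) + Bin m (λ d q → Bin q (λ r t → F d r (suc t))))
      ≡⟨ cong (Bin m (λ d q → Bin q (λ r t → F (suc d) r t)) +_)
           (Bin-+ m (λ d q → Bin q (λ r t → F d (suc r) t)) (λ d q → Bin q (λ r t → F d r (suc t)))) ⟨
    Bin (suc m) (λ d q → Bin q (λ r t → F d r t)) ∎
    where
    X Y Z : ℕ
    X = Bin m (λ s t → Bin s (λ d r → F (suc d) r t))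
    Y = Bin m (λ s t → Bin s (λ d r → F d (suc r) t))
    Z = Bin m (λ s t → Bin s (λ d r → F d r (suc t)))

  Word : Set
  Word = List ℕ

  Σw : ℕ → ℕ → (Word → ℕ) → ℕ
  Σw N zero    f = f []
  Σw N (suc m) f = Σ< N λ i → Σw N m (f ∘ (i ∷_))

  Σw-cong : ∀ N m {f g} → (∀ w → length w ≡ m → f w ≡ g w) → Σw N m f ≡ Σw N m g
  Σw-cong N zero    h = h [] refl
  Σw-cong N (suc m) h = Σ<-cong N λ i _ → Σw-cong N m λ w eq → h (i ∷ w) (cong suc eq)

  Σw-+ : ∀ N m f g → Σw N m (λ w → f w + g w) ≡ Σw N m f + Σw N m g
  Σw-+ N zero    f g = refl
  Σw-+ N (suc m) f g = trans
    (Σ<-cong N λ i _ → Σw-+ N m (f ∘ (i ∷_)) (g ∘ (i ∷_)))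
    (Σ<-+ N (λ i → Σw N m (f ∘ (i ∷_))) (λ i → Σw N m (g ∘ (i ∷_))))

  Σw-*ˡ : ∀ c N m f → Σw N m (λ w → c * f w) ≡ c * Σw N m f
  Σw-*ˡ c N zero    f = refl
  Σw-*ˡ c N (suc m) f = trans
    (Σ<-cong N λ i _ → Σw-*ˡ c N m (f ∘ (i ∷_)))
    (Σ<-*ˡ c N (λ i → Σw N m (f ∘ (i ∷_))))

  Σw-*ʳ : ∀ c N m f → Σw N m (λ w → f w * c) ≡ Σw N m f * c
  Σw-*ʳ c N m f = begin
    Σw N m (λ w → f w * c) ≡⟨ Σw-cong N m (λ w _ → *-comm (f w) c) ⟩
    Σw N m (λ w → c * f w) ≡⟨ Σw-*ˡ c N m f ⟩
    c * Σw N m f           ≡⟨ *-comm c _ ⟩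
    Σw N m f * c           ∎

  Σw-zero : ∀ N m {f} → (∀ w → length w ≡ m → f w ≡ 0) → Σw N m f ≡ 0
  Σw-zero N m h = trans (Σw-cong N m h) (Σw-*ˡ 0 N m (λ _ → 0))

  Σw-Σ< : ∀ N m n (F : ℕ → Word → ℕ) →
          Σw N m (λ w → Σ< n (λ i → F i w)) ≡ Σ< n (λ i → Σw N m (F i))
  Σw-Σ< N m zero    F = Σw-zero N m λ _ _ → refl
  Σw-Σ< N m (suc n) F = trans (Σw-+ N m (F 0) (λ w → Σ< n (λ i → F (suc i) w)))
                              (cong (Σw N m (F 0) +_) (Σw-Σ< N m n (F ∘ suc)))

  Σw-1 : ∀ N m → Σw N m (const 1) ≡ N ^ m
  Σw-1 N zero    = refl
  Σw-1 N (suc m) = trans (Σ<-cong N λ _ _ → Σw-1 N m) (Σ<-const N (N ^ m))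

  -- Letters from A on are lowered by A, so that the small and the large letters of a word both form
  -- words over alphabets that begin at 0.
  side : ℕ → ℕ → ℕ ⊎ ℕ
  side zero    p       = inj₂ p
  side (suc A) zero    = inj₁ 0
  side (suc A) (suc p) = map₁ suc (side A p)

  side-< : ∀ {A} i → i < A → side A i ≡ inj₁ i
  side-< {suc A} zero    _       = refl
  side-< {suc A} (suc i) (s<s i<A) = cong (map₁ suc) (side-< i i<A)

  side-+ : ∀ A i → side A (A + i) ≡ inj₂ i
  side-+ zero    i = refl
  side-+ (suc A) i = cong (map₁ suc) (side-+ A i)

  lo hi : ℕ → Word → Word
  lo A []      = []
  lo A (p ∷ w) = [ _∷ lo A w , const (lo A w) ]′ (side A p)
  hi A []      = []
  hi A (p ∷ w) = [ const (hi A w) , _∷ hi A w ]′ (side A p)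

  -- A word is determined by its small subword, its large subword and the way they are interleaved;
  -- `Bin` counts the interleavings.
  Σw-split : ∀ A B m (F : Word → Word → ℕ) →
             Σw (A + B) m (λ w → F (lo A w) (hi A w)) ≡
             Bin m (λ s t → Σw A s (λ u → Σw B t (F u)))
  Σw-split A B zero    F = refl
  Σw-split A B (suc m) F = begin
    Σ< (A + B) (λ i → Σw (A + B) m (λ w → F (lo A (i ∷ w)) (hi A (i ∷ w))))
      ≡⟨ Σ<-++ A B _ ⟩
    Σ< A (λ i → Σw (A + B) m (λ w → F (lo A (i ∷ w)) (hi A (i ∷ w)))) +
    Σ< B (λ i → Σw (A + B) m (λ w → F (lo A ((A + i) ∷ w)) (hi A ((A + i) ∷ w))))
      ≡⟨ cong₂ _+_ (Σ<-cong A lower) (Σ<-cong B upper) ⟩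
    Σ< A (λ i → Bin m (λ s t → Σw A s (λ u → Σw B t (F (i ∷ u))))) +
    Σ< B (λ i → Bin m (λ s t → Σw A s (λ u → Σw B t (F u ∘ (i ∷_)))))
      ≡⟨ cong₂ _+_ (Bin-Σ< m A _)
          (trans (Bin-Σ< m B _)
            (Bin-cong m λ s t _ → sym (Σw-Σ< A s B (λ i u → Σw B t (F u ∘ (i ∷_)))))) ⟩
    Bin (suc m) (λ s t → Σw A s (λ u → Σw B t (F u))) ∎
    where
    lower : ∀ i → i < A →
            Σw (A + B) m (λ w → F (lo A (i ∷ w)) (hi A (i ∷ w))) ≡
            Bin m (λ s t → Σw A s (λ u → Σw B t (F (i ∷ u))))
    lower i i<A rewrite side-< i i<A = Σw-split A B m (F ∘ (i ∷_))
    upper : ∀ i → i < B →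
            Σw (A + B) m (λ w → F (lo A ((A + i) ∷ w)) (hi A ((A + i) ∷ w))) ≡
            Bin m (λ s t → Σw A s (λ u → Σw B t (F u ∘ (i ∷_))))
    upper i _ rewrite side-+ A i = Σw-split A B m (λ u → F u ∘ (i ∷_))

  -- Street capacity

  δ : ℕ → ℕ → ℕ
  δ zero    zero    = 1
  δ zero    (suc n) = 0
  δ (suc m) zero    = 0
  δ (suc m) (suc n) = δ m n

  δ-cases : ∀ m n → (m ≡ n) ⊎ (δ m n ≡ 0)
  δ-cases zero    zero    = inj₁ refl
  δ-cases zero    (suc n) = inj₂ refl
  δ-cases (suc m) zero    = inj₂ refl
  δ-cases (suc m) (suc n) with δ-cases m n
  ... | inj₁ eq = inj₁ (cong suc eq)
  ... | inj₂ eq = inj₂ eq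

  pos : ℕ → ℕ
  pos zero    = 0
  pos (suc n) = 1

  zeros : Word → ℕ
  zeros w = length (lo 1 w)

  lo-zero : ∀ w → lo 0 w ≡ []
  lo-zero []      = refl
  lo-zero (p ∷ w) = lo-zero w

  hi-zero : ∀ w → hi 0 w ≡ w
  hi-zero []      = refl
  hi-zero (p ∷ w) = cong (p ∷_) (hi-zero w)

  length-lo-hi : ∀ A w → length (lo A w) + length (hi A w) ≡ length w
  length-lo-hi A []      = refl
  length-lo-hi A (p ∷ w) with side A p
  ... | inj₁ _ = cong suc (length-lo-hi A w)
  ... | inj₂ _ = trans (+-suc _ _) (cong suc (length-lo-hi A w))

  lo-1-lo : ∀ A w → lo 1 (lo (suc A) w) ≡ lo 1 w
  lo-1-lo A []          = refl
  lo-1-lo A (zero ∷ w)  = cong (0 ∷_) (lo-1-lo A w)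
  lo-1-lo A (suc p ∷ w) with side A p
  ... | inj₁ _ = lo-1-lo A w
  ... | inj₂ _ = lo-1-lo A w

  hi-1-lo : ∀ A w → hi 1 (lo (suc A) w) ≡ lo A (hi 1 w)
  hi-1-lo A []          = refl
  hi-1-lo A (zero ∷ w)  = hi-1-lo A w
  hi-1-lo A (suc p ∷ w) with side A p
  ... | inj₁ q = cong (q ∷_) (hi-1-lo A w)
  ... | inj₂ _ = hi-1-lo A w

  hi-hi-1 : ∀ A w → hi A (hi 1 w) ≡ hi (suc A) w
  hi-hi-1 A []          = refl
  hi-hi-1 A (zero ∷ w)  = hi-hi-1 A w
  hi-hi-1 A (suc p ∷ w) with side A p
  ... | inj₁ _ = hi-hi-1 A w
  ... | inj₂ q = cong (q ∷_) (hi-hi-1 A w)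

  length-lo-suc : ∀ A w → length (lo (suc A) w) ≡ zeros w + length (lo A (hi 1 w))
  length-lo-suc A w = begin
    length (lo (suc A) w)
      ≡⟨ length-lo-hi 1 (lo (suc A) w) ⟨
    zeros (lo (suc A) w) + length (hi 1 (lo (suc A) w))
      ≡⟨ cong₂ (λ x y → length x + length y) (lo-1-lo A w) (hi-1-lo A w) ⟩
    zeros w + length (lo A (hi 1 w)) ∎

  -- fits N u w = 1 if u cars arriving from the left and cars with preferences w
  -- leave nobody unparked on N empty spots, and 0 otherwise.
  fits : ℕ → ℕ → Word → ℕ
  fits zero    u w = δ 0 (u + length w)
  fits (suc N) u w = fits N ((u + zeros w) ∸ 1) (hi 1 w)

  -- full k u w = 1 if these cars fill the first k spots, and 0 otherwise.
  full : ℕ → ℕ → Word → ℕ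
  full zero    u w = 1
  full (suc k) u w = pos (u + zeros w) * full k ((u + zeros w) ∸ 1) (hi 1 w)

  -- firstGap e u w = 1 if spot e is the first one left empty, and 0 otherwise.
  firstGap : ℕ → ℕ → Word → ℕ
  firstGap zero    u w = δ 0 (u + zeros w)
  firstGap (suc e) u w = pos (u + zeros w) * firstGap e ((u + zeros w) ∸ 1) (hi 1 w)

  u+length-hi : ∀ u w → (u + zeros w) + length (hi 1 w) ≡ u + length w
  u+length-hi u w = trans (+-assoc u (zeros w) _) (cong (u +_) (length-lo-hi 1 w))

  -- Each spot absorbs at most one car, so a surplus of cars over spots persists until the end of
  -- the street.
  fits-overflow : ∀ N u w → N < u + length w → fits N u w ≡ 0
  fits-overflow zero    u w h with u + length w
  ... | suc _ = refl
  fits-overflow (suc N) u w h = fits-overflow N (u + zeros w ∸ 1) (hi 1 w) (s≤s⁻¹ (≤-trans h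
    (subst (_≤ suc ((u + zeros w ∸ 1) + length (hi 1 w))) (u+length-hi u w)
      (+-monoˡ-≤ (length (hi 1 w)) (m≤n+m∸n (u + zeros w) 1)))))

  -- With as many cars as spots, a spot left empty would force too many cars onto the others, so all
  -- of the first k + 1 spots must be filled. The condition on the last of these is kept apart as
  -- `pos`: once the first k are full it depends only on the number of cars, and in `pos-count` it
  -- merges with the weight s - k.
  fits-split : ∀ k M u w → u + length w ≡ suc k + M →
    fits (suc k + M) u w ≡
    full k u (lo (suc k) w) *
      (pos (u + length (lo (suc k) w) ∸ k) * fits M (u + length (lo (suc k) w) ∸ suc k) (hi (suc k) w))
  fits-split zero M u w eq with u + zeros w | u+length-hi u w
  ... | zero  | h = fits-overflow M 0 (hi 1 w) (≤-reflexive (sym (trans h eq)))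
  ... | suc x | h = sym (trans (*-identityˡ _) (*-identityˡ _))
  fits-split (suc k) M u w eq
    rewrite length-lo-suc (suc k) w | sym (+-assoc u (zeros w) (length (lo (suc k) (hi 1 w))))
          | lo-1-lo (suc k) w | hi-1-lo (suc k) w | sym (hi-hi-1 (suc k) w)
    with u + zeros w | u+length-hi u w
  ... | zero  | h = fits-overflow (suc k + M) 0 (hi 1 w) (≤-reflexive (sym (trans h eq)))
  ... | suc x | h rewrite fits-split k M x (hi 1 w) (suc-injective (trans h eq)) =
    let v = lo (suc k) (hi 1 w) in
    cong (_* (pos (x + length v ∸ k) * fits M (x + length v ∸ suc k) (hi (suc k) (hi 1 w))))
         (sym (*-identityˡ (full k x v)))

  full-firstGap : ∀ e u w → full e u w ≡ full (suc e) u w + firstGap e u w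
  full-firstGap zero    u w with u + zeros w
  ... | zero  = refl
  ... | suc _ = refl
  full-firstGap (suc e) u w
    rewrite full-firstGap e (u + zeros w ∸ 1) (hi 1 w) =
    *-distribˡ-+ (pos (u + zeros w)) (full (suc e) (u + zeros w ∸ 1) (hi 1 w)) _

  full-or-gap : ∀ k u w → full k u w + Σ< k (λ e → firstGap e u w) ≡ 1
  full-or-gap zero    u w = refl
  full-or-gap (suc k) u w = begin
    full (suc k) u w + Σ< (suc k) (λ e → firstGap e u w)
      ≡⟨ cong (full (suc k) u w +_) (trans (Σ<-last k _) (+-comm _ (firstGap k u w))) ⟩
    full (suc k) u w + (firstGap k u w + Σ< k (λ e → firstGap e u w))
      ≡⟨ +-assoc (full (suc k) u w) _ _ ⟨
    full (suc k) u w + firstGap k u w + Σ< k (λ e → firstGap e u w)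
      ≡⟨ cong (_+ Σ< k (λ e → firstGap e u w)) (full-firstGap k u w) ⟨
    full k u w + Σ< k (λ e → firstGap e u w)
      ≡⟨ full-or-gap k u w ⟩
    1 ∎

  -- A first gap at spot e means that exactly e cars come to the spots before it, that they all find
  -- room there and thus fill them, and that nobody prefers e.
  firstGap-split : ∀ e u w → firstGap e u w ≡
    δ e (u + length (lo e w)) * fits e u (lo e w) * δ 0 (zeros (hi e w))
  firstGap-split zero zero    w rewrite lo-zero w | hi-zero w = sym (*-identityˡ _)
  firstGap-split zero (suc u) w = refl
  firstGap-split (suc e) u w
    rewrite length-lo-suc e w | sym (+-assoc u (zeros w) (length (lo e (hi 1 w))))
          | lo-1-lo e w | hi-1-lo e w | sym (hi-hi-1 e w)
    with u + zeros w
  ... | suc x = trans (*-identityˡ _) (firstGap-split e x (hi 1 w))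
  -- The first spot is empty, so the left side is 0. On the right, e + 1 cars would have to fit into
  -- the e spots behind it.
  ... | zero with δ-cases (suc e) (length (lo e (hi 1 w)))
  ...   | inj₂ δ≡0 rewrite δ≡0 = refl
  ...   | inj₁ eq
          rewrite fits-overflow e 0 (lo e (hi 1 w)) (≤-reflexive eq)
                | *-zeroʳ (δ (suc e) (length (lo e (hi 1 w)))) = refl

  -- Binomial moments and the number of ways to complete a parking function

  Bin-^ : ∀ a b m → Bin m (λ s t → a ^ s * b ^ t) ≡ (a + b) ^ m
  Bin-^ a b zero    = refl
  Bin-^ a b (suc m) = begin
    Bin m (λ s t → a * a ^ s * b ^ t) + Bin m (λ s t → a ^ s * (b * b ^ t))
      ≡⟨ cong₂ _+_ (trans (Bin-cong m λ s t _ → *-assoc a (a ^ s) (b ^ t)) (Bin-*ˡ a m _))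
                   (trans (Bin-cong m λ s t _ → comm (a ^ s) b (b ^ t)) (Bin-*ˡ b m _)) ⟩
    a * Bin m (λ s t → a ^ s * b ^ t) + b * Bin m (λ s t → a ^ s * b ^ t)
      ≡⟨ *-distribʳ-+ _ a b ⟨
    (a + b) * Bin m (λ s t → a ^ s * b ^ t)
      ≡⟨ cong ((a + b) *_) (Bin-^ a b m) ⟩
    (a + b) ^ suc m ∎
    where
    comm : ∀ x b y → x * (b * y) ≡ b * (x * y)
    comm = solve-∀

  -- This is the first moment m a (a+b)^(m-1), multiplied by a + b to avoid the exponent m - 1 at m
  -- = 0.
  Bin-s^ : ∀ a b m → (a + b) * Bin m (λ s t → s * (a ^ s * b ^ t)) ≡ m * a * (a + b) ^ m
  Bin-s^ a b zero    = *-zeroʳ (a + b)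
  Bin-s^ a b (suc m) = begin
    c * (Bin m (λ s t → suc s * (a * a ^ s * b ^ t)) + Bin m (λ s t → s * (a ^ s * (b * b ^ t))))
      ≡⟨ cong (c *_) (cong₂ _+_ first second) ⟩
    c * (a * c ^ m + a * S + b * S)
      ≡⟨ regroup a b (c ^ m) S ⟩
    a * (c * c ^ m) + c * (c * S)
      ≡⟨ cong (λ x → a * (c * c ^ m) + c * x) (Bin-s^ a b m) ⟩
    a * (c * c ^ m) + c * (m * a * c ^ m)
      ≡⟨ collect a c m (c ^ m) ⟩
    suc m * a * c ^ suc m ∎
    where
    c S : ℕ
    c = a + b
    S = Bin m (λ s t → s * (a ^ s * b ^ t))
    regroup : ∀ a b x S → (a + b) * (a * x + a * S + b * S) ≡ a * ((a + b) * x) + (a + b) * ((a + b) * S)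
    regroup = solve-∀
    collect : ∀ a c m x → a * (c * x) + c * (m * a * x) ≡ suc m * a * (c * x)
    collect = solve-∀
    expand : ∀ s a x y → suc s * (a * x * y) ≡ a * (x * y) + a * (s * (x * y))
    expand = solve-∀
    comm : ∀ s x b y → s * (x * (b * y)) ≡ b * (s * (x * y))
    comm = solve-∀
    first : Bin m (λ s t → suc s * (a * a ^ s * b ^ t)) ≡ a * c ^ m + a * S
    first = begin
      Bin m (λ s t → suc s * (a * a ^ s * b ^ t))
        ≡⟨ Bin-cong m (λ s t _ → expand s a (a ^ s) (b ^ t)) ⟩
      Bin m (λ s t → a * (a ^ s * b ^ t) + a * (s * (a ^ s * b ^ t)))
        ≡⟨ Bin-+ m (λ s t → a * (a ^ s * b ^ t)) _ ⟩
      Bin m (λ s t → a * (a ^ s * b ^ t)) + Bin m (λ s t → a * (s * (a ^ s * b ^ t)))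
        ≡⟨ cong₂ _+_ (trans (Bin-*ˡ a m _) (cong (a *_) (Bin-^ a b m))) (Bin-*ˡ a m _) ⟩
      a * c ^ m + a * S ∎
    second : Bin m (λ s t → s * (a ^ s * (b * b ^ t))) ≡ b * S
    second = trans (Bin-cong m λ s t _ → comm s (a ^ s) b (b ^ t)) (Bin-*ˡ b m _)

  -- For u = 0 this is the classical number (M+1)^(M-1) of parking functions. If s cars prefer the
  -- first spot, then u + s - 1 are pushed on to the next one, and induction contributes the weight
  -- u + s; the sum over s is therefore a combination of the zeroth and the first binomial moment.
  fits-count : ∀ M u L → u + L ≡ M → suc M * Σw M L (fits M u) ≡ suc u * suc M ^ L
  fits-count zero    zero zero eq = refl
  fits-count (suc M) u    L    eq = *-cancelˡ-≡ _ _ (suc M) (begin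
    suc M * (c * Σw (suc M) L (fits (suc M) u))
      ≡⟨ swap (suc M) c (Σw (suc M) L (fits (suc M) u)) ⟩
    c * (suc M * Σw (suc M) L (fits (suc M) u))
      ≡⟨ cong (λ x → c * (suc M * x)) (Σw-split 1 M L (λ v → fits M (u + length v ∸ 1))) ⟩
    c * (suc M * Bin L (λ s t → Σw 1 s (λ v → Σw M t (fits M (u + length v ∸ 1)))))
      ≡⟨ cong (c *_) (Bin-*ˡ (suc M) L _) ⟨
    c * Bin L (λ s t → suc M * Σw 1 s (λ v → Σw M t (fits M (u + length v ∸ 1))))
      ≡⟨ cong (c *_) (Bin-cong L term) ⟩
    c * Bin L (λ s t → u * (1 ^ s * suc M ^ t) + s * (1 ^ s * suc M ^ t))
      ≡⟨ cong (c *_) (trans (Bin-+ L _ _) (cong (_+ S) (trans (Bin-*ˡ u L _) (cong (u *_) (Bin-^ 1 (suc M) L))))) ⟩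
    c * (u * c ^ L + S)
      ≡⟨ *-distribˡ-+ c (u * c ^ L) S ⟩
    c * (u * c ^ L) + c * S
      ≡⟨ cong (c * (u * c ^ L) +_) (Bin-s^ 1 (suc M) L) ⟩
    c * (u * c ^ L) + L * 1 * c ^ L
      ≡⟨ final (suc M) u L (c ^ L) eq ⟩
    suc M * (suc u * c ^ L) ∎)
    where
    c S : ℕ
    c = suc (suc M)
    S = Bin L (λ s t → s * (1 ^ s * suc M ^ t))
    swap : ∀ x y z → x * (y * z) ≡ y * (x * z)
    swap = solve-∀
    identity : ∀ u L x → suc (u + L) * (u * x) + L * 1 * x ≡ (u + L) * (suc u * x)
    identity = solve-∀
    final : ∀ N u L x → u + L ≡ N → suc N * (u * x) + L * 1 * x ≡ N * (suc u * x)
    final _ u L x refl = identity u L x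
    value : ∀ s t → s + t ≡ L → suc M * Σw M t (fits M (u + s ∸ 1)) ≡ (u + s) * suc M ^ t
    value s t s+t≡L with u + s | trans (+-assoc u s t) (trans (cong (u +_) s+t≡L) eq)
    -- Nobody takes the first spot, and the M + 1 cars overflow the M spots behind it: the truncated
    -- `u + s ∸ 1` does no harm because both sides are 0.
    ... | zero  | h = trans
      (cong (suc M *_) (Σw-zero M t λ w ∣w∣≡t → fits-overflow M 0 w (≤-reflexive (sym (trans ∣w∣≡t h)))))
      (*-zeroʳ (suc M))
    ... | suc x | h = fits-count M x t (suc-injective h)
    distrib : ∀ u s y → (u + s) * y ≡ u * (1 * y) + s * (1 * y)
    distrib = solve-∀
    term : ∀ s t → s + t ≡ L →
           suc M * Σw 1 s (λ v → Σw M t (fits M (u + length v ∸ 1))) ≡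
           u * (1 ^ s * suc M ^ t) + s * (1 ^ s * suc M ^ t)
    term s t s+t≡L = begin
      suc M * Σw 1 s (λ v → Σw M t (fits M (u + length v ∸ 1)))
        ≡⟨ cong (suc M *_) (Σw-cong 1 s λ v ∣v∣≡s →
             trans (cong (λ l → Σw M t (fits M (u + l ∸ 1))) ∣v∣≡s) (sym (*-identityʳ _))) ⟩
      suc M * Σw 1 s (λ v → Σw M t (fits M (u + s ∸ 1)) * 1)
        ≡⟨ cong (suc M *_) (trans (Σw-*ˡ (Σw M t (fits M (u + s ∸ 1))) 1 s (const 1)) (trans (cong (Σw M t (fits M (u + s ∸ 1)) *_) (trans (Σw-1 1 s) (^-zeroˡ s))) (*-identityʳ _))) ⟩
      suc M * Σw M t (fits M (u + s ∸ 1))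
        ≡⟨ value s t s+t≡L ⟩
      (u + s) * suc M ^ t
        ≡⟨ distrib u s _ ⟩
      u * (1 * suc M ^ t) + s * (1 * suc M ^ t)
        ≡⟨ cong (λ x → u * (x * suc M ^ t) + s * (x * suc M ^ t)) (^-zeroˡ s) ⟨
      u * (1 ^ s * suc M ^ t) + s * (1 ^ s * suc M ^ t) ∎

  -- Parking with an occupancy set

  side-side : ∀ A p {q} → side A p ≡ inj₁ q → side A q ≡ inj₁ q
  side-side (suc A) zero    refl = refl
  side-side (suc A) (suc p) eq with side A p in eq′
  side-side (suc A) (suc p) refl | inj₁ q = cong (map₁ suc) (side-side A p eq′)

  side-suc : ∀ A p → side (suc A) p ≡ [ inj₁ , (λ { zero → inj₁ A ; (suc q) → inj₂ q }) ]′ (side A p)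
  side-suc zero    zero    = refl
  side-suc zero    (suc p) = refl
  side-suc (suc A) zero    = refl
  side-suc (suc A) (suc p) rewrite side-suc A p with side A p
  ... | inj₁ q       = refl
  ... | inj₂ zero    = refl
  ... | inj₂ (suc q) = refl

  side-++ : ∀ A B p → side (A + B) p ≡ [ inj₁ , (λ r → map₁ (A +_) (side B r)) ]′ (side A p)
  side-++ zero    B p with side B p
  ... | inj₁ q = refl
  ... | inj₂ q = refl
  side-++ (suc A) B zero    = refl
  side-++ (suc A) B (suc p) rewrite side-++ A B p with side A p
  ... | inj₁ q = refl
  ... | inj₂ r with side B r
  ...   | inj₁ q = refl
  ...   | inj₂ q = refl

  -- This is `firstAvailable` as a recursion along the street, which can be followed through a
  -- concatenation of streets; `find-available` identifies the two.
  spot : ∀ {n} → Vec Bool n → ℕ → Maybe (Fin n)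
  spot []          p       = nothing
  spot (b ∷ o)     (suc p) = Maybe.map Fin.suc (spot o p)
  spot (false ∷ o) zero    = just Fin.zero
  spot (true ∷ o)  zero    = Maybe.map Fin.suc (spot o 0)

  spot-++ : ∀ {m n} (o : Vec Bool m) (o′ : Vec Bool n) p →
    spot (o ++ o′) p ≡
    [ (λ q → maybe′ (just ∘ (_↑ˡ n)) (Maybe.map (m ↑ʳ_) (spot o′ 0)) (spot o q))
    , (λ r → Maybe.map (m ↑ʳ_) (spot o′ r)) ]′ (side m p)
  spot-++ []          o′ p    = sym (Maybe.map-id (spot o′ p))
  spot-++ (false ∷ o) o′ zero = refl
  spot-++ (true ∷ []) o′ zero = refl
  spot-++ (true ∷ o@(_ ∷ _)) o′ zero rewrite spot-++ o o′ 0 with spot o 0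
  ... | just t  = refl
  ... | nothing = sym (Maybe.map-∘ (spot o′ 0))
  spot-++ {suc m} (b ∷ o) o′ (suc p) rewrite spot-++ o o′ p with side m p
  ... | inj₂ r = sym (Maybe.map-∘ (spot o′ r))
  ... | inj₁ q with spot o q
  ...   | just t  = refl
  ...   | nothing = sym (Maybe.map-∘ (spot o′ 0))

  park : ∀ {n} → Vec Bool n → Word → ℕ
  park o []      = 1
  park o (p ∷ w) = maybe′ (λ t → park (o [ t ]≔ true) w) 0 (spot o p)

  bit : Bool → ℕ
  bit false = 0
  bit true  = 1

  -- Generalises fits to a street that is already partly occupied.
  fitsFrom : ∀ {n} → Vec Bool n → ℕ → Word → ℕ
  fitsFrom []      u w = δ 0 (u + length w)
  fitsFrom (b ∷ o) u w = fitsFrom o ((u + (bit b + zeros w)) ∸ 1) (hi 1 w)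

  fitsFrom-0 : ∀ {n} (o : Vec Bool n) u w → fitsFrom o u (0 ∷ w) ≡ fitsFrom o (suc u) w
  fitsFrom-0 []      u w = cong (δ 0) (+-suc u (length w))
  fitsFrom-0 (b ∷ o) u w = cong (λ x → fitsFrom o (x ∸ 1) (hi 1 w)) (shift u (bit b) (zeros w))
    where
    shift : ∀ u b z → u + (b + suc z) ≡ suc (u + (b + z))
    shift = solve-∀

  -- This is where the order of arrival drops out. A parked car counts in the balance of its spot
  -- just as a waiting car does, so parking the first car in advance changes nothing for the spots
  -- from there on.
  fitsFrom-∷ : ∀ {n} (o : Vec Bool n) u p w →
    fitsFrom o u (p ∷ w) ≡ maybe′ (λ t → fitsFrom (o [ t ]≔ true) u w) 0 (spot o p)
  fitsFrom-∷ []          u p       w = cong (δ 0) (+-suc u (length w))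
  fitsFrom-∷ (false ∷ o) u zero    w = refl
  -- The spot is taken, so one car more goes on to the next spot; `fitsFrom-0` turns it into a car
  -- preferring that spot, to which induction applies.
  fitsFrom-∷ (true ∷ o)  u zero    w
    rewrite +-suc u (suc (zeros w)) | +-suc u (zeros w)
          | sym (fitsFrom-0 o (u + zeros w) (hi 1 w)) | fitsFrom-∷ o (u + zeros w) 0 (hi 1 w)
    with spot o 0
  ... | just t rewrite +-suc u (zeros w) = refl
  ... | nothing = refl
  fitsFrom-∷ (b ∷ o)     u (suc p) w
    rewrite fitsFrom-∷ o (u + (bit b + zeros w) ∸ 1) p (hi 1 w) with spot o p
  ... | just t  = refl
  ... | nothing = refl

  fitsFrom-[] : ∀ {n} (o : Vec Bool n) → fitsFrom o 0 [] ≡ 1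
  fitsFrom-[] []          = refl
  fitsFrom-[] (false ∷ o) = fitsFrom-[] o
  fitsFrom-[] (true ∷ o)  = fitsFrom-[] o

  park-fitsFrom : ∀ {n} (o : Vec Bool n) w → park o w ≡ fitsFrom o 0 w
  park-fitsFrom o []      = sym (fitsFrom-[] o)
  park-fitsFrom o (p ∷ w) rewrite fitsFrom-∷ o 0 p w with spot o p
  ... | just t  = park-fitsFrom (o [ t ]≔ true) w
  ... | nothing = refl

  fitsFrom-empty : ∀ n u w → fitsFrom (replicate n false) u w ≡ fits n u w
  fitsFrom-empty zero    u w = refl
  fitsFrom-empty (suc n) u w = fitsFrom-empty n (u + zeros w ∸ 1) (hi 1 w)

  park-fits : ∀ n w → park (replicate n false) w ≡ fits n 0 w
  park-fits n w = trans (park-fitsFrom _ w) (fitsFrom-empty n 0 w)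

  -- lucky o w = 1 if, starting from the occupancy o of the spots before spot k and
  -- with spot k empty, spot k gets taken by a car preferring it, and 0 otherwise.
  lucky : ∀ {k} → Vec Bool k → Word → ℕ
  lucky o []          = 0
  lucky {k} o (p ∷ w) =
    [ (λ q → maybe′ (λ t → lucky (o [ t ]≔ true) w) 0 (spot o q))
    , (λ { zero → 1 ; (suc _) → lucky o w }) ]′ (side k p)

  lucky-lo : ∀ {k} (o : Vec Bool k) w → lucky o (lo (suc k) w) ≡ lucky o w
  lucky-lo o []          = refl
  lucky-lo {k} o (p ∷ w) rewrite side-suc k p with side k p in eq
  ... | inj₂ zero rewrite subst (λ x → side k x ≡ inj₂ 0) (+-identityʳ k) (side-+ k 0) = refl
  ... | inj₂ (suc _) = lucky-lo o w
  ... | inj₁ q rewrite side-side k p eq with spot o q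
  ...   | just t  = lucky-lo (o [ t ]≔ true) w
  ...   | nothing = refl

  []≔true-↑ˡ : ∀ {m n} (o : Vec Bool m) (o′ : Vec Bool n) t →
            (o ++ o′) [ t ↑ˡ n ]≔ true ≡ (o [ t ]≔ true) ++ o′
  []≔true-↑ˡ = []≔-++-↑ˡ

  []≔true-↑ʳ : ∀ {m n} (o : Vec Bool m) (o′ : Vec Bool n) t →
            (o ++ o′) [ m ↑ʳ t ]≔ true ≡ o ++ (o′ [ t ]≔ true)
  []≔true-↑ʳ = []≔-++-↑ʳ

  replicate-+ : ∀ k M → replicate (k + M) false ≡ replicate k false ++ replicate M false
  replicate-+ zero    M = refl
  replicate-+ (suc k) M = cong (false ∷_) (replicate-+ k M)

  -- The common factor vanishes unless spot e stays empty. In that case no car crosses it, and the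
  -- stretches on its two sides evolve independently.
  lucky-gap : ∀ {e k} (o : Vec Bool e) (o′ : Vec Bool k) w →
    park o (lo e w) * δ 0 (zeros (hi e w)) * lucky (o ++ false ∷ o′) w ≡
    park o (lo e w) * δ 0 (zeros (hi e w)) * lucky o′ (hi 1 (hi e w))
  lucky-gap o o′ [] = refl
  lucky-gap {e} {k} o o′ (p ∷ w)
    rewrite side-++ e (suc k) p with side e p in eq
  ... | inj₁ q rewrite spot-++ o (false ∷ o′) q | side-side e p eq with spot o q
  ...   | nothing = refl
  ...   | just t rewrite []≔true-↑ˡ o (false ∷ o′) t = lucky-gap (o [ t ]≔ true) o′ w
  -- This car prefers the gap itself, which makes the common factor 0.
  lucky-gap {e} {k} o o′ (p ∷ w) | inj₂ zero rewrite *-zeroʳ (park o (lo e w)) = refl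
  lucky-gap {e} {k} o o′ (p ∷ w) | inj₂ (suc r) with side k r
  ... | inj₂ zero    = refl
  ... | inj₂ (suc _) = lucky-gap o o′ w
  ... | inj₁ q rewrite spot-++ o (false ∷ o′) (e + suc q) | side-+ e (suc q) with spot o′ q
  ...   | nothing = refl
  ...   | just t rewrite []≔true-↑ʳ o (false ∷ o′) (Fin.suc t) = lucky-gap o (o′ [ t ]≔ true) w

  -- When the fate of spot k is decided

  empties : ∀ {k} → Vec Bool k → ℕ
  empties []          = 0
  empties (false ∷ o) = suc (empties o)
  empties (true ∷ o)  = empties o

  empties-spot : ∀ {k} (o : Vec Bool k) p {t} → spot o p ≡ just t →
                 empties o ≡ suc (empties (o [ t ]≔ true))
  empties-spot (false ∷ o) zero refl = refl
  empties-spot (true ∷ o)  zero eq with spot o 0 in eq′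
  empties-spot (true ∷ o)  zero refl | just t = empties-spot o 0 eq′
  empties-spot (b ∷ o)  (suc p) eq with spot o p in eq′
  empties-spot (false ∷ o) (suc p) refl | just t = cong suc (empties-spot o p eq′)
  empties-spot (true ∷ o)  (suc p) refl | just t = empties-spot o p eq′

  empties-replicate : ∀ k → empties (replicate k false) ≡ k
  empties-replicate zero    = refl
  empties-replicate (suc k) = cong suc (empties-replicate k)

  -- With more cars than empty spots before spot k, its fate is decided before the last car comes.
  Σw-lucky-suc : ∀ {k} (o : Vec Bool k) s → empties o < s →
                 Σw (suc k) (suc s) (lucky o) ≡ suc k * Σw (suc k) s (lucky o)
  Σw-lucky-suc {k} o (suc s) (s≤s o<s) = begin
    Σ< (suc k) (f (suc s))
      ≡⟨ Σ<-last k (f (suc s)) ⟩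
    Σ< k (f (suc s)) + f (suc s) k
      ≡⟨ cong₂ _+_ (Σ<-cong k before) (trans (at (suc s)) (cong (suc k *_) (sym (at s)))) ⟩
    Σ< k (λ i → suc k * f s i) + suc k * f s k
      ≡⟨ cong (_+ suc k * f s k) (Σ<-*ˡ (suc k) k (f s)) ⟩
    suc k * Σ< k (f s) + suc k * f s k
      ≡⟨ *-distribˡ-+ (suc k) (Σ< k (f s)) (f s k) ⟨
    suc k * (Σ< k (f s) + f s k)
      ≡⟨ cong (suc k *_) (Σ<-last k (f s)) ⟨
    suc k * Σ< (suc k) (f s) ∎
    where
    f : ℕ → ℕ → ℕ
    f s i = Σw (suc k) s (λ w → lucky o (i ∷ w))
    at : ∀ s → f s k ≡ suc k ^ s
    at s rewrite subst (λ x → side k x ≡ inj₂ 0) (+-identityʳ k) (side-+ k 0) = Σw-1 (suc k) s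
    before : ∀ i → i < k → f (suc s) i ≡ suc k * f s i
    before i i<k rewrite side-< i i<k with spot o i in eq
    ... | just t = Σw-lucky-suc (o [ t ]≔ true) s (subst (_≤ s) (empties-spot o i eq) o<s)
    -- The car finds everything before spot k taken and occupies spot k against its preference, so
    -- both sides are 0.
    ... | nothing = trans (Σw-zero (suc k) (suc s) λ _ _ → refl)
          (sym (trans (cong (suc k *_) (Σw-zero (suc k) s λ _ _ → refl)) (*-zeroʳ (suc k))))

  luckyWords : ℕ → ℕ → ℕ
  luckyWords k s = Σw (suc k) s (lucky (replicate k false))

  luckyWords-^ : ∀ k i → luckyWords k (i + suc k) ≡ suc k ^ i * luckyWords k (suc k)
  luckyWords-^ k zero    = sym (*-identityˡ _)
  luckyWords-^ k (suc i) = begin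
    luckyWords k (suc (i + suc k))
      ≡⟨ Σw-lucky-suc (replicate k false) (i + suc k)
           (subst (_< i + suc k) (sym (empties-replicate k)) (m≤n+m (suc k) i)) ⟩
    suc k * luckyWords k (i + suc k)
      ≡⟨ cong (suc k *_) (luckyWords-^ k i) ⟩
    suc k * (suc k ^ i * luckyWords k (suc k))
      ≡⟨ *-assoc (suc k) (suc k ^ i) _ ⟨
    suc k ^ suc i * luckyWords k (suc k) ∎

  -- Reduction of the definitions to words

  toWord : ∀ {n m} → Vec (Fin n) m → Word
  toWord []       = []
  toWord (p ∷ ps) = toℕ p ∷ toWord ps

  𝟙 : ∀ {P : Set} → Dec P → ℕ
  𝟙 d = if does d then 1 else 0

  module _ {A : Set} where

    length-filter-∷ : ∀ {P : A → Set} (P? : Decidable P) x xs →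
      length (filter P? (x ∷ xs)) ≡ 𝟙 (P? x) + length (filter P? xs)
    length-filter-∷ P? x xs with does (P? x)
    ... | true  = refl
    ... | false = refl

    length-filter-filter : ∀ {P Q : A → Set} (P? : Decidable P) (Q? : Decidable Q) xs →
      length (filter Q? (filter P? xs)) ≡ sum (List.map (λ x → 𝟙 (P? x) * 𝟙 (Q? x)) xs)
    length-filter-filter P? Q? []       = refl
    length-filter-filter P? Q? (x ∷ xs) with does (P? x)
    ... | false = length-filter-filter P? Q? xs
    ... | true  = trans (length-filter-∷ Q? x (filter P? xs))
      (cong₂ _+_ (sym (+-identityʳ (𝟙 (Q? x)))) (length-filter-filter P? Q? xs))

    -- Double counting: the sum over i is exchanged with the sum over x, so it has to be known only
    -- for a fixed x.
    sum-length-filter : ∀ {I : Set} {R : I → A → Set} {S : A → Set}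
      (R? : ∀ i → Decidable (R i)) (S? : Decidable S) is →
      (∀ x → sum (List.map (λ i → 𝟙 (R? i x)) is) ≡ 𝟙 (S? x)) → ∀ xs →
      sum (List.map (λ i → length (filter (R? i) xs)) is) ≡ length (filter S? xs)
    sum-length-filter R? S? is h [] = empty is
      where
      empty : ∀ is → sum (List.map (λ i → length (filter (R? i) [])) is) ≡ 0
      empty []       = refl
      empty (i ∷ is) = empty is
    sum-length-filter R? S? is h (x ∷ xs) = begin
      sum (List.map (λ i → length (filter (R? i) (x ∷ xs))) is)
        ≡⟨ cong sum (map-cong (λ i → length-filter-∷ (R? i) x xs) is) ⟩
      sum (List.map (λ i → 𝟙 (R? i x) + length (filter (R? i) xs)) is)
        ≡⟨ split is ⟩
      sum (List.map (λ i → 𝟙 (R? i x)) is) + sum (List.map (λ i → length (filter (R? i) xs)) is)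
        ≡⟨ cong₂ _+_ (h x) (sum-length-filter R? S? is h xs) ⟩
      𝟙 (S? x) + length (filter S? xs)
        ≡⟨ length-filter-∷ S? x xs ⟨
      length (filter S? (x ∷ xs)) ∎
      where
      split : ∀ is → sum (List.map (λ i → 𝟙 (R? i x) + length (filter (R? i) xs)) is) ≡
        sum (List.map (λ i → 𝟙 (R? i x)) is) + sum (List.map (λ i → length (filter (R? i) xs)) is)
      split []       = refl
      split (i ∷ is) rewrite split is =
        +-interchange (𝟙 (R? i x)) (length (filter (R? i) xs)) _ _

  sum-allFin : ∀ n (f : Fin n → ℕ) g → (∀ i → f i ≡ g (toℕ i)) →
               sum (List.map f (allFin n)) ≡ Σ< n g
  sum-allFin n f g h = trans (cong sum (map-tabulate (λ i → i) f)) (tab n f g h)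
    where
    tab : ∀ n (f : Fin n → ℕ) g → (∀ i → f i ≡ g (toℕ i)) → sum (List.tabulate f) ≡ Σ< n g
    tab zero    f g h = refl
    tab (suc n) f g h = cong₂ _+_ (h Fin.zero) (tab n (f ∘ Fin.suc) (g ∘ suc) (h ∘ Fin.suc))

  sum-cartesianProductWith : ∀ {A B C : Set} (c : A → B → C) (f : C → ℕ) xs ys →
    sum (List.map f (cartesianProductWith c xs ys)) ≡
    sum (List.map (λ x → sum (List.map (f ∘ c x) ys)) xs)
  sum-cartesianProductWith c f []       ys = refl
  sum-cartesianProductWith c f (x ∷ xs) ys = begin
    sum (List.map f (List.map (c x) ys List.++ cartesianProductWith c xs ys))
      ≡⟨ cong sum (map-++ f (List.map (c x) ys) _) ⟩
    sum (List.map f (List.map (c x) ys) List.++ List.map f (cartesianProductWith c xs ys))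
      ≡⟨ sum-++ (List.map f (List.map (c x) ys)) _ ⟩
    sum (List.map f (List.map (c x) ys)) + sum (List.map f (cartesianProductWith c xs ys))
      ≡⟨ cong₂ _+_ (cong sum (sym (map-∘ ys))) (sum-cartesianProductWith c f xs ys) ⟩
    sum (List.map (λ x → sum (List.map (f ∘ c x) ys)) (x ∷ xs)) ∎

  sum-allVecs : ∀ n m (f : Vec (Fin n) m → ℕ) g → (∀ a → f a ≡ g (toWord a)) →
                sum (List.map f (allVecs n m)) ≡ Σw n m g
  sum-allVecs n zero    f g h = trans (+-identityʳ _) (h [])
  sum-allVecs n (suc m) f g h = trans
    (sum-cartesianProductWith _∷_ f (allFin n) (allVecs n m))
    (sum-allFin n _ _ λ i → sum-allVecs n m (f ∘ (i ∷_)) (g ∘ (toℕ i ∷_)) (h ∘ (i ∷_)))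

  -- The given outcome, followed along the street

  module _ {A B : Set} where

    find-map : ∀ {P : B → Set} (P? : Decidable P) (f : A → B) xs →
               find P? (List.map f xs) ≡ Maybe.map f (find (P? ∘ f) xs)
    find-map P? f []       = refl
    find-map P? f (x ∷ xs) with does (P? (f x))
    ... | true  = refl
    ... | false = find-map P? f xs

  find-cong : ∀ {A : Set} {P Q : A → Set} (P? : Decidable P) (Q? : Decidable Q) →
              (∀ x → P x ⇔ Q x) → ∀ xs → find P? xs ≡ find Q? xs
  find-cong P? Q? h []       = refl
  find-cong P? Q? h (x ∷ xs) rewrite does-⇔ (h x) (P? x) (Q? x) | find-cong P? Q? h xs = refl

  available? : ∀ {n} (occ : Subset n) (p : ℕ) → Decidable (λ s → p ≤ toℕ s × ¬ s ∈ occ)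
  available? occ p s = (p ≤? toℕ s) ×-dec ¬? (s ∈? occ)

  find-available : ∀ {n} (occ : Subset n) p → find (available? occ p) (allFin n) ≡ spot occ p
  find-available []            p       = refl
  find-available (false ∷ occ) zero    = refl
  find-available {suc n} (true ∷ occ) zero = begin
    find (available? (true ∷ occ) 0) (List.tabulate Fin.suc)
      ≡⟨ cong (find (available? (true ∷ occ) 0)) (map-tabulate (λ i → i) Fin.suc) ⟨
    find (available? (true ∷ occ) 0) (List.map Fin.suc (allFin n))
      ≡⟨ find-map (available? (true ∷ occ) 0) Fin.suc (allFin n) ⟩
    Maybe.map Fin.suc (find (available? (true ∷ occ) 0 ∘ Fin.suc) (allFin n))
      ≡⟨ cong (Maybe.map Fin.suc) (find-cong _ (available? occ 0)
           (λ s → mk⇔ (λ (_ , s∉) → z≤n , s∉ ∘ there) (λ (_ , s∉) → z≤n , s∉ ∘ drop-there)) (allFin n)) ⟩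
    Maybe.map Fin.suc (find (available? occ 0) (allFin n))
      ≡⟨ cong (Maybe.map Fin.suc) (find-available occ 0) ⟩
    Maybe.map Fin.suc (spot occ 0) ∎
  find-available {suc n} (b ∷ occ) (suc p) = begin
    find (available? (b ∷ occ) (suc p)) (List.tabulate Fin.suc)
      ≡⟨ cong (find (available? (b ∷ occ) (suc p))) (map-tabulate (λ i → i) Fin.suc) ⟨
    find (available? (b ∷ occ) (suc p)) (List.map Fin.suc (allFin n))
      ≡⟨ find-map (available? (b ∷ occ) (suc p)) Fin.suc (allFin n) ⟩
    Maybe.map Fin.suc (find (available? (b ∷ occ) (suc p) ∘ Fin.suc) (allFin n))
      ≡⟨ cong (Maybe.map Fin.suc) (find-cong _ (available? occ p)
           (λ s → mk⇔ (λ (p≤s , s∉) → s≤s⁻¹ p≤s , s∉ ∘ there) (λ (p≤s , s∉) → s≤s p≤s , s∉ ∘ drop-there)) (allFin n)) ⟩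
    Maybe.map Fin.suc (find (available? occ p) (allFin n))
      ≡⟨ cong (Maybe.map Fin.suc) (find-available occ p) ⟩
    Maybe.map Fin.suc (spot occ p) ∎

  firstAvailable-spot : ∀ {n} (occ : Subset n) p → firstAvailable occ p ≡ spot occ (toℕ p)
  firstAvailable-spot occ p = find-available occ (toℕ p)

  ∪-⁅⁆ : ∀ {n} (occ : Subset n) t → occ ∪ ⁅ t ⁆ ≡ occ [ t ]≔ true
  ∪-⁅⁆ (b ∷ occ) Fin.zero    = cong₂ _∷_ (∨-zeroʳ b) (∪-identityʳ occ)
  ∪-⁅⁆ (b ∷ occ) (Fin.suc t) = cong₂ _∷_ (∨-identityʳ b) (∪-⁅⁆ occ t)

  occupy : ∀ {n} → Subset n → Maybe (Fin n) → Subset n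
  occupy occ = maybe′ (λ t → occ [ t ]≔ true) occ

  parkFrom-∷ : ∀ {n m} (occ : Subset n) p (ps : Vec (Fin n) m) →
    parkFrom occ (p ∷ ps) ≡ spot occ (toℕ p) ∷ parkFrom (occupy occ (spot occ (toℕ p))) ps
  parkFrom-∷ occ p ps rewrite firstAvailable-spot occ p with spot occ (toℕ p)
  ... | nothing = refl
  ... | just t  = cong (λ o → just t ∷ parkFrom o ps) (∪-⁅⁆ occ t)

  spot-free : ∀ {n} (occ : Subset n) p {t} → spot occ p ≡ just t → lookup occ t ≡ false
  spot-free (false ∷ occ) zero refl = refl
  spot-free (true ∷ occ)  zero eq with spot occ 0 in eq′
  spot-free (true ∷ occ)  zero refl | just t = spot-free occ 0 eq′
  spot-free (b ∷ occ)  (suc p) eq with spot occ p in eq′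
  spot-free (b ∷ occ)  (suc p) refl | just t = spot-free occ p eq′

  occupy-mono : ∀ {n} (occ : Subset n) {s} x → lookup occ s ≡ true → lookup (occupy occ x) s ≡ true
  occupy-mono occ       nothing  eq = eq
  occupy-mono (b ∷ occ) {Fin.zero}  (just Fin.zero)    eq = refl
  occupy-mono (b ∷ occ) {Fin.zero}  (just (Fin.suc t)) eq = eq
  occupy-mono (b ∷ occ) {Fin.suc s} (just Fin.zero)    eq = eq
  occupy-mono (b ∷ occ) {Fin.suc s} (just (Fin.suc t)) eq = occupy-mono occ (just t) eq

  never-retaken : ∀ {n m} (occ : Subset n) (ps : Vec (Fin n) m) {s} → lookup occ s ≡ true →
                  ∀ i → lookup (parkFrom occ ps) i ≢ just s
  never-retaken occ (p ∷ ps) taken i eq rewrite parkFrom-∷ occ p ps with i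
  ... | Fin.suc i′ = never-retaken _ ps (occupy-mono occ (spot occ (toℕ p)) taken) i′ eq
  ... | Fin.zero with () ← trans (sym taken) (spot-free occ (toℕ p) eq)

  outcome-injective : ∀ {n m} (occ : Subset n) (ps : Vec (Fin n) m) {s} i j →
    lookup (parkFrom occ ps) i ≡ just s → lookup (parkFrom occ ps) j ≡ just s → i ≡ j
  outcome-injective occ (p ∷ ps) {s} i j eqᵢ eqⱼ rewrite parkFrom-∷ occ p ps with i | j
  ... | Fin.zero   | Fin.zero   = refl
  ... | Fin.suc i′ | Fin.suc j′ = cong Fin.suc (outcome-injective _ ps i′ j′ eqᵢ eqⱼ)
  ... | Fin.zero   | Fin.suc j′ rewrite eqᵢ =
    ⊥-elim (never-retaken (occ [ s ]≔ true) ps (lookup∘updateAt s occ) j′ eqⱼ)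
  ... | Fin.suc i′ | Fin.zero   rewrite eqⱼ =
    ⊥-elim (never-retaken (occ [ s ]≔ true) ps (lookup∘updateAt s occ) i′ eqᵢ)

  -- Ties a computed number to the truth of P without choosing a decision procedure; `𝟙-unique` then
  -- compares the number with whichever procedure a definition uses.
  Indicates : ℕ → Set → Set
  Indicates x P = (P × x ≡ 1) ⊎ (¬ P × x ≡ 0)

  𝟙-unique : ∀ {P x} → Indicates x P → (P? : Dec P) → 𝟙 P? ≡ x
  𝟙-unique (inj₁ (_  , refl)) (yes _) = refl
  𝟙-unique (inj₁ (p  , _))    (no ¬p) = ⊥-elim (¬p p)
  𝟙-unique (inj₂ (¬p , _))    (yes p) = ⊥-elim (¬p p)
  𝟙-unique (inj₂ (_  , refl)) (no _)  = refl

  Indicates-⇔ : ∀ {P Q x} → (P → Q) → (Q → P) → Indicates x P → Indicates x Q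
  Indicates-⇔ f g (inj₁ (p  , eq)) = inj₁ (f p , eq)
  Indicates-⇔ f g (inj₂ (¬p , eq)) = inj₂ (¬p ∘ g , eq)

  sum-unique : ∀ n {R : Fin n → Set} (R? : Decidable R) → (∀ i j → R i → R j → i ≡ j) →
               Indicates (sum (List.tabulate (𝟙 ∘ R?))) (∃ R)
  sum-unique zero    R? unique = inj₂ ((λ ()) , refl)
  sum-unique (suc n) {R} R? unique with R? Fin.zero
  ... | no ¬r = Indicates-⇔ (λ (i , r) → Fin.suc i , r)
                  (λ { (Fin.zero , r) → ⊥-elim (¬r r) ; (Fin.suc i , r) → i , r })
                  (sum-unique n (R? ∘ Fin.suc) (λ i j r r′ → Fin.suc-injective (unique _ _ r r′)))
  ... | yes r = inj₁ ((Fin.zero , r) , cong suc (rest n (R? ∘ Fin.suc) λ i r′ → case unique _ _ r r′ of λ ()))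
    where
    rest : ∀ n {Q : Fin n → Set} (Q? : Decidable Q) → (∀ i → ¬ Q i) → sum (List.tabulate (𝟙 ∘ Q?)) ≡ 0
    rest zero    Q? none = refl
    rest (suc n) Q? none with Q? Fin.zero
    ... | yes q = ⊥-elim (none Fin.zero q)
    ... | no _  = rest n (Q? ∘ Fin.suc) (none ∘ Fin.suc)

  -- No two cars park in the same spot, so for each parking function at most one car contributes to
  -- the sum, and one does exactly when the spot is lucky.
  luckySpotCount≡sumOfQ : ∀ n j → luckySpotCount n j ≡ sumOfQ n j
  luckySpotCount≡sumOfQ n j = sym (sum-length-filter
    (λ i a → prefers? a i j ×-dec luckyCar? a i) (λ a → luckySpot? a j) (allFin n)
    (λ a → trans (cong sum (map-tabulate (λ i → i) (λ i → 𝟙 (prefers? a i j ×-dec luckyCar? a i))))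
      (sym (𝟙-unique (Indicates-⇔
        (λ { (i , refl , lucky) → i , lucky , refl })
        (λ { (i , parks , refl) → i , refl , parks })
        (sum-unique n (λ i → prefers? a i j ×-dec luckyCar? a i)
          λ { i i′ (eq , l) (eq′ , l′) → outcome-injective Subset.⊥ a i i′
                (trans l (cong just eq)) (trans l′ (cong just eq′)) })) (luckySpot? a j))))
    (parkingFunctions n))

  park-indicates : ∀ {n m} (occ : Subset n) (ps : Vec (Fin n) m) →
    Indicates (park occ (toWord ps)) (∀ i → ∃ λ s → lookup (parkFrom occ ps) i ≡ just s)
  park-indicates occ []       = inj₁ ((λ ()) , refl)
  park-indicates occ (p ∷ ps) rewrite parkFrom-∷ occ p ps with spot occ (toℕ p)
  ... | nothing = inj₂ ((λ all → case all Fin.zero of λ ()) , refl)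
  ... | just t  = Indicates-⇔ (λ { all Fin.zero → t , refl ; all (Fin.suc i) → all i })
                    (λ all → all ∘ Fin.suc) (park-indicates (occ [ t ]≔ true) ps)

  side-inj₂ : ∀ A p {r} → side A p ≡ inj₂ r → p ≡ A + r
  side-inj₂ zero    p       refl = refl
  side-inj₂ (suc A) (suc p) eq with side A p in eq′
  side-inj₂ (suc A) (suc p) refl | inj₂ r = cong suc (side-inj₂ A p eq′)

  LuckyFrom : ∀ {n m} → Subset n → Vec (Fin n) m → Fin n → Set
  LuckyFrom occ ps s = ∃ λ i → lookup (parkFrom occ ps) i ≡ just s × lookup ps i ≡ s

  LuckyFrom-∷ : ∀ {n m} {occ : Subset n} {p} {ps : Vec (Fin n) m} {s x} y →
    spot occ (toℕ p) ≡ y → ¬ (y ≡ just s × p ≡ s) →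
    Indicates x (LuckyFrom (occupy occ y) ps s) → Indicates x (LuckyFrom occ (p ∷ ps) s)
  LuckyFrom-∷ {occ = occ} {p} {ps} y refl notFirst ind rewrite parkFrom-∷ occ p ps =
    Indicates-⇔ (λ (i , l) → Fin.suc i , l)
      (λ { (Fin.zero , l) → ⊥-elim (notFirst l) ; (Fin.suc i , l) → i , l }) ind

  ↑ˡ≢↑ʳ : ∀ {m n} (i : Fin m) (j : Fin n) → i ↑ˡ n ≢ m ↑ʳ j
  ↑ˡ≢↑ʳ (Fin.suc i) j eq = ↑ˡ≢↑ʳ i j (Fin.suc-injective eq)

  -- The induction maintains that spot k is still empty. The first car to take it decides the
  -- matter, because a taken spot is never retaken.
  lucky-indicates : ∀ {k M m} (o : Vec Bool k) (o′ : Vec Bool M) (ps : Vec (Fin (k + suc M)) m) →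
    Indicates (lucky o (toWord ps)) (LuckyFrom (o ++ false ∷ o′) ps (k ↑ʳ Fin.zero))
  lucky-indicates o o′ [] = inj₂ ((λ ()) , refl)
  lucky-indicates {k} {M} o o′ (p ∷ ps)
    with side k (toℕ p) in eq | spot-++ o (false ∷ o′) (toℕ p)
  ... | inj₂ zero | landing =
    inj₁ ((Fin.zero , trans (cong (λ v → lookup v Fin.zero) (parkFrom-∷ _ p ps)) landing ,
      toℕ-injective (trans (side-inj₂ k (toℕ p) eq) (sym (toℕ-↑ʳ k Fin.zero)))) , refl)
  ... | inj₂ (suc r) | landing with spot o′ r
  ...   | nothing = LuckyFrom-∷ nothing landing (λ ()) (lucky-indicates o o′ ps)
  ...   | just t  = LuckyFrom-∷ (just (k ↑ʳ Fin.suc t)) landing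
          (λ (eq′ , _) → case ↑ʳ-injective k _ _ (just-injective eq′) of λ ())
          (subst (λ occ → Indicates _ (LuckyFrom occ ps _)) (sym ([]≔true-↑ʳ o (false ∷ o′) (Fin.suc t)))
            (lucky-indicates o (o′ [ t ]≔ true) ps))
  lucky-indicates {k} {M} o o′ (p ∷ ps) | inj₁ q | landing with spot o q
  ... | just t = LuckyFrom-∷ (just (t ↑ˡ suc M)) landing
          (λ (eq′ , _) → ↑ˡ≢↑ʳ t Fin.zero (just-injective eq′))
          (subst (λ occ → Indicates _ (LuckyFrom occ ps _)) (sym ([]≔true-↑ˡ o (false ∷ o′) t))
            (lucky-indicates (o [ t ]≔ true) o′ ps))
  -- A car preferring an earlier spot ends up in spot k, which excludes any later lucky car there.
  ... | nothing = LuckyFrom-∷ (just (k ↑ʳ Fin.zero)) landing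
          (λ { (_ , refl) → case trans (sym eq) (trans (cong (side k) (toℕ-↑ʳ k Fin.zero)) (side-+ k 0)) of λ () })
          (inj₂ ((λ (i , parks , _) → never-retaken _ ps (lookup∘updateAt (k ↑ʳ Fin.zero) (o ++ false ∷ o′)) i parks) , refl))


  luckySpotCount-Σw : ∀ k M → let n = k + suc M in
    luckySpotCount n (k ↑ʳ Fin.zero) ≡ Σw n n (λ w → fits n 0 w * lucky (replicate k false) w)
  luckySpotCount-Σw k M = trans
    (length-filter-filter isParkingFunction? (λ a → luckySpot? a (k ↑ʳ Fin.zero)) (allVecs n n))
    (sum-allVecs n n _ _ λ a → cong₂ _*_
      (trans (𝟙-unique (park-indicates Subset.⊥ a) (isParkingFunction? a)) (park-fits n (toWord a)))
      (𝟙-unique (subst (λ occ → Indicates (lucky (replicate k false) (toWord a)) (LuckyFrom occ a (k ↑ʳ Fin.zero))) (sym (replicate-+ k (suc M)))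
        (lucky-indicates (replicate k false) (replicate M false) a)) (luckySpot? a (k ↑ʳ Fin.zero))))
    where
    n : ℕ
    n = k + suc M

  -- The recurrence for lucky words

  -- For s > k this is `fits-count` with u = s - k - 1 cars pushed on. For s at most k both sides
  -- are 0, so truncated subtraction takes over the role of `pos`.
  pos-count : ∀ k M s t → s + t ≡ suc k + M →
    suc M * (pos (s ∸ k) * Σw M t (fits M (s ∸ suc k))) ≡ (s ∸ k) * suc M ^ t
  pos-count k M s t eq with s ∸ k in s∸k
  ... | zero  = *-zeroʳ (suc M)
  ... | suc u = begin
    suc M * (1 * Σw M t (fits M (s ∸ suc k)))
      ≡⟨ cong (suc M *_) (*-identityˡ _) ⟩
    suc M * Σw M t (fits M (s ∸ suc k))
      ≡⟨ cong (λ x → suc M * Σw M t (fits M x)) s∸1+k ⟩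
    suc M * Σw M t (fits M u)
      ≡⟨ fits-count M u t (+-cancelˡ-≡ (suc k) (u + t) M (trans (rearrange k u t) (trans (cong (_+ t) (sym s≡)) eq))) ⟩
    suc u * suc M ^ t ∎
    where
    s∸1+k : s ∸ suc k ≡ u
    s∸1+k = trans (sym (pred[m∸n]≡m∸[1+n] s k)) (cong pred s∸k)
    k≤s : k ≤ s
    k≤s = <⇒≤ (m∸n≢0⇒n<m λ s∸k≡0 → 0≢1+n (trans (sym s∸k≡0) s∸k))
    s≡ : s ≡ k + suc u
    s≡ = trans (sym (m+[n∸m]≡n k≤s)) (cong (k +_) s∸k)
    rearrange : ∀ k u t → suc k + (u + t) ≡ k + suc u + t
    rearrange = solve-∀

  luckyFull : ℕ → ℕ → ℕ
  luckyFull k s = Σw (suc k) s (λ v → full k 0 v * lucky (replicate k false) v)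

  -- Only d = e gives a nonzero value, the number of parking functions of length e. Keeping d as a
  -- parameter lets the splitting of a word be an ordinary `Bin`, which `Bin-single` collapses
  -- later.
  gapWords : ℕ → ℕ → ℕ
  gapWords e d = Σw e d (λ u → δ e (length u) * fits e 0 u)

  lucky-count : ∀ k M n → n ≡ suc k + M →
    suc M * Σw n n (λ w → fits n 0 w * lucky (replicate k false) w) ≡
    Bin n (λ s t → luckyFull k s * ((s ∸ k) * suc M ^ t))
  lucky-count k M n refl = begin
    suc M * Σw n n (λ w → fits n 0 w * lucky (replicate k false) w)
      ≡⟨ cong (suc M *_) (Σw-cong n n pointwise) ⟩
    suc M * Σw n n (λ w → F (lo (suc k) w) (hi (suc k) w))
      ≡⟨ cong (suc M *_) (Σw-split (suc k) M n F) ⟩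
    suc M * Bin n (λ s t → Σw (suc k) s (λ v → Σw M t (F v)))
      ≡⟨ Bin-*ˡ (suc M) n (λ s t → Σw (suc k) s (λ v → Σw M t (F v))) ⟨
    Bin n (λ s t → suc M * Σw (suc k) s (λ v → Σw M t (F v)))
      ≡⟨ Bin-cong n term ⟩
    Bin n (λ s t → luckyFull k s * ((s ∸ k) * suc M ^ t)) ∎
    where
    l : Word → ℕ
    l = lucky (replicate k false)
    F : Word → Word → ℕ
    F v w = full k 0 v * l v * (pos (length v ∸ k) * fits M (length v ∸ suc k) w)
    comm : ∀ x y z → x * y * z ≡ x * z * y
    comm = solve-∀
    pointwise : ∀ w → length w ≡ n → fits n 0 w * l w ≡ F (lo (suc k) w) (hi (suc k) w)
    pointwise w eq rewrite fits-split k M 0 w eq | sym (lucky-lo (replicate k false) w) =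
      comm (full k 0 (lo (suc k) w)) _ (l (lo (suc k) w))
    swap : ∀ b x y → b * (x * y) ≡ x * (b * y)
    swap = solve-∀
    term : ∀ s t → s + t ≡ n →
           suc M * Σw (suc k) s (λ v → Σw M t (F v)) ≡ luckyFull k s * ((s ∸ k) * suc M ^ t)
    term s t eq = begin
      suc M * Σw (suc k) s (λ v → Σw M t (F v))
        ≡⟨ cong (suc M *_) (Σw-cong (suc k) s λ v ∣v∣ → inner v ∣v∣) ⟩
      suc M * Σw (suc k) s (λ v → full k 0 v * l v * R)
        ≡⟨ cong (suc M *_) (Σw-*ʳ R (suc k) s _) ⟩
      suc M * (luckyFull k s * R)
        ≡⟨ swap (suc M) (luckyFull k s) R ⟩
      luckyFull k s * (suc M * R)
        ≡⟨ cong (luckyFull k s *_) (pos-count k M s t eq) ⟩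
      luckyFull k s * ((s ∸ k) * suc M ^ t) ∎
      where
      R : ℕ
      R = pos (s ∸ k) * Σw M t (fits M (s ∸ suc k))
      inner : ∀ v → length v ≡ s → Σw M t (F v) ≡ full k 0 v * l v * R
      inner v refl = trans (Σw-*ˡ (full k 0 v * l v) M t _)
        (cong (full k 0 v * l v *_) (Σw-*ˡ (pos (length v ∸ k)) M t _))

  Σw-no-zeros : ∀ N m f → Σw (suc N) m (λ w → δ 0 (zeros w) * f (hi 1 w)) ≡ Σw N m f
  Σw-no-zeros N zero    f = *-identityˡ (f [])
  Σw-no-zeros N (suc m) f = cong₂ _+_ (Σw-zero (suc N) m λ _ _ → refl)
                                      (Σ<-cong N λ i _ → Σw-no-zeros N m (f ∘ (i ∷_)))

  firstGap-count : ∀ e k s →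
    Σw (suc (e + suc k)) s (λ w → firstGap e 0 w * lucky (replicate (e + suc k) false) w) ≡
    Bin s (λ d r → gapWords e d * luckyWords k r)
  firstGap-count e k s = begin
    Σw (suc (e + suc k)) s (λ w → firstGap e 0 w * lucky (replicate (e + suc k) false) w)
      ≡⟨ cong (λ N → Σw N s (λ w → firstGap e 0 w * lucky (replicate (e + suc k) false) w)) (+-suc e (suc k)) ⟨
    Σw (e + suc (suc k)) s (λ w → firstGap e 0 w * lucky (replicate (e + suc k) false) w)
      ≡⟨ Σw-cong (e + suc (suc k)) s (λ w _ → pointwise w) ⟩
    Σw (e + suc (suc k)) s (λ w → F (lo e w) (hi e w))
      ≡⟨ Σw-split e (suc (suc k)) s F ⟩
    Bin s (λ d r → Σw e d (λ u → Σw (suc (suc k)) r (F u)))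
      ≡⟨ Bin-cong s (λ d r _ → trans
           (Σw-cong e d λ u _ → trans (Σw-*ˡ (g u) (suc (suc k)) r _) (cong (g u *_) (Σw-no-zeros (suc k) r l)))
           (Σw-*ʳ (luckyWords k r) e d g)) ⟩
    Bin s (λ d r → gapWords e d * luckyWords k r) ∎
    where
    g l : Word → ℕ
    g u = δ e (length u) * fits e 0 u
    l = lucky (replicate k false)
    F : Word → Word → ℕ
    F u v = g u * (δ 0 (zeros v) * l (hi 1 v))
    regroup₁ : ∀ a b c d → a * b * c * d ≡ a * (b * c * d)
    regroup₁ = solve-∀
    regroup₂ : ∀ a b c d → a * (b * c * d) ≡ a * b * (c * d)
    regroup₂ = solve-∀
    pointwise : ∀ w → firstGap e 0 w * lucky (replicate (e + suc k) false) w ≡ F (lo e w) (hi e w)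
    pointwise w = begin
      firstGap e 0 w * lucky (replicate (e + suc k) false) w
        ≡⟨ cong₂ _*_ (firstGap-split e 0 w) (cong (λ o → lucky o w) (replicate-+ e (suc k))) ⟩
      Δ * fits e 0 (lo e w) * Z * lucky (replicate e false ++ false ∷ replicate k false) w
        -- `lucky-gap` follows the cars one by one, so `fits` is exchanged for the simulation `park`
        -- and restored afterwards.
        ≡⟨ cong (λ x → Δ * x * Z * lucky (replicate e false ++ false ∷ replicate k false) w) (park-fits e (lo e w)) ⟨
      Δ * P * Z * lucky (replicate e false ++ false ∷ replicate k false) w
        ≡⟨ regroup₁ Δ P Z _ ⟩
      Δ * (P * Z * lucky (replicate e false ++ false ∷ replicate k false) w)
        ≡⟨ cong (Δ *_) (lucky-gap (replicate e false) (replicate k false) w) ⟩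
      Δ * (P * Z * l (hi 1 (hi e w)))
        ≡⟨ regroup₂ Δ P Z _ ⟩
      Δ * P * (Z * l (hi 1 (hi e w)))
        ≡⟨ cong (λ x → Δ * x * (Z * l (hi 1 (hi e w)))) (park-fits e (lo e w)) ⟩
      F (lo e w) (hi e w) ∎
      where
      Δ P Z : ℕ
      Δ = δ e (length (lo e w))
      P = park (replicate e false) (lo e w)
      Z = δ 0 (zeros (hi e w))

  luckyWords-decompose : ∀ k s → luckyWords k s ≡
    luckyFull k s + Σ< k (λ e → Bin s (λ d r → gapWords e d * luckyWords (k ∸ suc e) r))
  luckyWords-decompose k s = begin
    luckyWords k s
      ≡⟨ Σw-cong (suc k) s (λ w _ → pointwise w) ⟩
    Σw (suc k) s (λ w → full k 0 w * l w + Σ< k (λ e → firstGap e 0 w * l w))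
      ≡⟨ Σw-+ (suc k) s _ _ ⟩
    luckyFull k s + Σw (suc k) s (λ w → Σ< k (λ e → firstGap e 0 w * l w))
      ≡⟨ cong (luckyFull k s +_) (Σw-Σ< (suc k) s k _) ⟩
    luckyFull k s + Σ< k (λ e → Σw (suc k) s (λ w → firstGap e 0 w * l w))
      ≡⟨ cong (luckyFull k s +_) (Σ<-cong k gap) ⟩
    luckyFull k s + Σ< k (λ e → Bin s (λ d r → gapWords e d * luckyWords (k ∸ suc e) r)) ∎
    where
    l : Word → ℕ
    l = lucky (replicate k false)
    pointwise : ∀ w → l w ≡ full k 0 w * l w + Σ< k (λ e → firstGap e 0 w * l w)
    pointwise w = begin
      l w
        ≡⟨ *-identityʳ (l w) ⟨
      l w * 1
        ≡⟨ cong (l w *_) (full-or-gap k 0 w) ⟨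
      l w * (full k 0 w + Σ< k (λ e → firstGap e 0 w))
        ≡⟨ *-distribˡ-+ (l w) (full k 0 w) _ ⟩
      l w * full k 0 w + l w * Σ< k (λ e → firstGap e 0 w)
        ≡⟨ cong₂ _+_ (*-comm (l w) (full k 0 w)) (trans (sym (Σ<-*ˡ (l w) k _)) (Σ<-cong k λ e _ → *-comm (l w) _)) ⟩
      full k 0 w * l w + Σ< k (λ e → firstGap e 0 w * l w) ∎
    gap : ∀ e → e < k → Σw (suc k) s (λ w → firstGap e 0 w * l w) ≡
                        Bin s (λ d r → gapWords e d * luckyWords (k ∸ suc e) r)
    gap e e<k = subst
      (λ k₁ → Σw (suc k₁) s (λ w → firstGap e 0 w * lucky (replicate k₁ false) w) ≡
              Bin s (λ d r → gapWords e d * luckyWords (k ∸ suc e) r))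
      (trans (+-suc e (k ∸ suc e)) (m+[n∸m]≡n e<k))
      (firstGap-count e (k ∸ suc e) s)

  Bin-single : ∀ e r F → (∀ s t → s ≢ e → F s t ≡ 0) → Bin (e + r) F ≡ ((e + r) C e) * F e r
  Bin-single zero    zero    F h = sym (*-identityˡ (F 0 0))
  Bin-single zero    (suc r) F h = begin
    Bin r (λ s t → F (suc s) t) + Bin r (λ s t → F s (suc t))
      ≡⟨ cong₂ _+_ (Bin-zero r λ s t _ → h (suc s) t λ ()) (Bin-single zero r _ λ s t → h s (suc t)) ⟩
    (r C 0) * F 0 (suc r)
      ≡⟨⟩
    (suc r C 0) * F 0 (suc r) ∎
  Bin-single (suc e) zero    F h = begin
    Bin (e + 0) (λ s t → F (suc s) t) + Bin (e + 0) (λ s t → F s (suc t))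
      ≡⟨ cong₂ _+_ (Bin-single e 0 _ λ s t s≢e → h (suc s) t (s≢e ∘ suc-injective))
           (Bin-zero (e + 0) λ s t eq → h s (suc t) λ { refl → 1+n≰n (m+n≤o⇒m≤o (suc e) (≤-reflexive (trans eq (+-identityʳ e)))) }) ⟩
    ((e + 0) C e) * F (suc e) 0 + 0
      ≡⟨ +-identityʳ _ ⟩
    ((e + 0) C e) * F (suc e) 0
      ≡⟨ cong (_* F (suc e) 0) (trans (binomial e) (sym (binomial (suc e)))) ⟩
    ((suc e + 0) C suc e) * F (suc e) 0 ∎
    where
    binomial : ∀ e → ((e + 0) C e) ≡ 1
    binomial e = trans (cong (_C e) (+-identityʳ e)) (nCn≡1 e)
  Bin-single (suc e) (suc r) F h = begin
    Bin (e + suc r) (λ s t → F (suc s) t) + Bin (e + suc r) (λ s t → F s (suc t))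
      ≡⟨ cong₂ _+_ (Bin-single e (suc r) _ λ s t s≢e → h (suc s) t (s≢e ∘ suc-injective))
           (cong (λ m → Bin m (λ s t → F s (suc t))) (+-suc e r)) ⟩
    ((e + suc r) C e) * X + Bin (suc e + r) (λ s t → F s (suc t))
      ≡⟨ cong (((e + suc r) C e) * X +_) (Bin-single (suc e) r _ λ s t → h s (suc t)) ⟩
    ((e + suc r) C e) * X + ((suc e + r) C suc e) * X
      ≡⟨ cong (λ m → ((e + suc r) C e) * X + (m C suc e) * X) (+-suc e r) ⟨
    ((e + suc r) C e) * X + ((e + suc r) C suc e) * X
      ≡⟨ *-distribʳ-+ X ((e + suc r) C e) _ ⟨
    (((e + suc r) C e) + ((e + suc r) C suc e)) * X
      ≡⟨ cong (_* X) (nCk+nC[k+1]≡[n+1]C[k+1] (e + suc r) e) ⟩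
    ((suc e + suc r) C suc e) * X ∎
    where
    X : ℕ
    X = F (suc e) (suc r)

  gapWords-≢ : ∀ e d → d ≢ e → gapWords e d ≡ 0
  gapWords-≢ e d d≢e = Σw-zero e d λ u ∣u∣≡d → cong (_* fits e 0 u) (δ-zero ∣u∣≡d)
    where
    δ-zero : ∀ {l} → l ≡ d → δ e l ≡ 0
    δ-zero {l} refl with δ-cases e l
    ... | inj₁ e≡l = ⊥-elim (d≢e (sym e≡l))
    ... | inj₂ δ≡0 = δ≡0

  luckyTotal : ℕ → ℕ → ℕ
  luckyTotal k n = Σw n n (λ w → fits n 0 w * lucky (replicate k false) w)

  -- Opaque, as conversion checking would otherwise expand excess 4 4 b (4 + b) word by word.
  opaque

    excess : ℕ → ℕ → ℕ → ℕ → ℕ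
    excess k j b m = Bin m (λ s t → luckyWords k s * ((s ∸ j) * b ^ t))

    excess-Bin : ∀ k j b m → excess k j b m ≡ Bin m (λ s t → luckyWords k s * ((s ∸ j) * b ^ t))
    excess-Bin k j b m = refl

  -- The words with first gap e contribute the e-th summand.
  lucky-recurrence : ∀ k M → let b = suc M ; n = k + b in
    b * luckyTotal k n +
      Σ< k (λ e → (n C e) * (gapWords e e * excess (k ∸ suc e) (k ∸ e) b (n ∸ e))) ≡
    excess k k b n
  lucky-recurrence k M = begin
    b * luckyTotal k n +
      Σ< k (λ e → (n C e) * (gapWords e e * excess (k ∸ suc e) (k ∸ e) b (n ∸ e)))
      ≡⟨ cong₂ _+_ (lucky-count k M n (+-suc k M)) (sym (Σ<-cong k gap)) ⟩
    Bin n (λ s t → luckyFull k s * W s t) + Σ< k (λ e → Bin n (λ s t → Bin s (G e) * W s t))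
      ≡⟨ cong (Bin n (λ s t → luckyFull k s * W s t) +_) (Bin-Σ< n k _) ⟩
    Bin n (λ s t → luckyFull k s * W s t) + Bin n (λ s t → Σ< k (λ e → Bin s (G e) * W s t))
      ≡⟨ Bin-+ n _ _ ⟨
    Bin n (λ s t → luckyFull k s * W s t + Σ< k (λ e → Bin s (G e) * W s t))
      ≡⟨ trans (Bin-cong n (λ s t _ → sym (collect s t))) (sym (excess-Bin k k b n)) ⟩
    excess k k b n ∎
    where
    b n : ℕ
    b = suc M
    n = k + b
    W : ℕ → ℕ → ℕ
    W s t = (s ∸ k) * b ^ t
    G : ℕ → ℕ → ℕ → ℕ
    G e d r = gapWords e d * luckyWords (k ∸ suc e) r
    collect : ∀ s t → luckyWords k s * W s t ≡ luckyFull k s * W s t + Σ< k (λ e → Bin s (G e) * W s t)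
    collect s t = begin
      luckyWords k s * W s t
        ≡⟨ cong (_* W s t) (luckyWords-decompose k s) ⟩
      (luckyFull k s + Σ< k (λ e → Bin s (G e))) * W s t
        ≡⟨ *-distribʳ-+ (W s t) (luckyFull k s) _ ⟩
      luckyFull k s * W s t + Σ< k (λ e → Bin s (G e)) * W s t
        ≡⟨ cong (luckyFull k s * W s t +_) (trans (*-comm _ (W s t))
             (trans (sym (Σ<-*ˡ (W s t) k _)) (Σ<-cong k λ e _ → *-comm (W s t) _))) ⟩
      luckyFull k s * W s t + Σ< k (λ e → Bin s (G e) * W s t) ∎
    swap : ∀ w g l → w * (g * l) ≡ g * (l * w)
    swap = solve-∀
    gap : ∀ e → e < k → Bin n (λ s t → Bin s (G e) * W s t) ≡
          (n C e) * (gapWords e e * excess (k ∸ suc e) (k ∸ e) b (n ∸ e))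
    gap e e<k = begin
      Bin n (λ s t → Bin s (G e) * W s t)
        ≡⟨ Bin-cong n (λ s t _ → trans (*-comm _ (W s t)) (trans (sym (Bin-*ˡ (W s t) s (G e)))
             (Bin-cong s λ { d r refl → swap (W (d + r) t) (gapWords e d) (luckyWords (k ∸ suc e) r) }))) ⟩
      Bin n (λ s t → Bin s (λ d r → gapWords e d * (luckyWords (k ∸ suc e) r * W (d + r) t)))
        -- Choosing the cars before the gap first leaves an inner sum over the remaining cars, and
        -- only d = e survives in the outer one.
        ≡⟨ Bin-assoc n (λ d r t → gapWords e d * (luckyWords (k ∸ suc e) r * W (d + r) t)) ⟩
      Bin n (λ d q → Bin q (λ r t → gapWords e d * (luckyWords (k ∸ suc e) r * W (d + r) t)))
        ≡⟨ Bin-cong n (λ d q _ → Bin-*ˡ (gapWords e d) q _) ⟩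
      Bin n (λ d q → gapWords e d * Bin q (λ r t → luckyWords (k ∸ suc e) r * W (d + r) t))
        ≡⟨ cong (λ m → Bin m (λ d q → gapWords e d * X d q)) (m+[n∸m]≡n e≤n) ⟨
      Bin (e + (n ∸ e)) (λ d q → gapWords e d * Bin q (λ r t → luckyWords (k ∸ suc e) r * W (d + r) t))
        ≡⟨ Bin-single e (n ∸ e) _ (λ d q d≢e → cong (_* X d q) (gapWords-≢ e d d≢e)) ⟩
      ((e + (n ∸ e)) C e) * (gapWords e e * Bin (n ∸ e) (λ r t → luckyWords (k ∸ suc e) r * W (e + r) t))
        ≡⟨ cong₂ (λ m x → (m C e) * (gapWords e e * x)) (m+[n∸m]≡n e≤n)
             (trans (Bin-cong (n ∸ e) λ r t _ → cong (λ x → luckyWords (k ∸ suc e) r * (x * b ^ t)) (shift r))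
                    (sym (excess-Bin (k ∸ suc e) (k ∸ e) b (n ∸ e)))) ⟩
      (n C e) * (gapWords e e * excess (k ∸ suc e) (k ∸ e) b (n ∸ e)) ∎
      where
      X : ℕ → ℕ → ℕ
      X d q = Bin q (λ r t → luckyWords (k ∸ suc e) r * W (d + r) t)
      e≤n : e ≤ n
      e≤n = ≤-trans (<⇒≤ e<k) (m≤m+n k b)
      -- The e cars before the gap lower the threshold to k - e. The words behind the gap also have
      -- k - e letters, so threshold and alphabet size agree, as `surplus-diagonal` requires.
      shift : ∀ r → e + r ∸ k ≡ r ∸ (k ∸ e)
      shift r = begin
        e + r ∸ k             ≡⟨ cong (e + r ∸_) (m+[n∸m]≡n (<⇒≤ e<k)) ⟨
        e + r ∸ (e + (k ∸ e)) ≡⟨ [m+n]∸[m+o]≡n∸o e r (k ∸ e) ⟩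
        r ∸ (k ∸ e)           ∎

  -- Evaluation of the binomial sums

  surplus : ℕ → ℕ → ℕ → ℕ → ℕ
  surplus j a b m = Bin m (λ s t → (s ∸ j) * (a ^ s * b ^ t))

  opaque

    deficit : ℕ → ℕ → ℕ → ℕ → ℕ
    deficit j a b m = Bin m (λ s t → (j ∸ s) * (a ^ s * b ^ t))

    deficit-Bin : ∀ j a b m → deficit j a b m ≡ Bin m (λ s t → (j ∸ s) * (a ^ s * b ^ t))
    deficit-Bin j a b m = refl

  -- The factor (k+1)^(k+1) turns the power s - k - 1 of `luckyWords-^` into the power s, which
  -- makes sense for all s. The terms with s at most k, where that law says nothing, carry the
  -- weight 0 since k is at most j.
  excess-surplus : ∀ k j b m → k ≤ j →
    suc k ^ suc k * excess k j b m ≡ luckyWords k (suc k) * surplus j (suc k) b m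
  excess-surplus k j b m k≤j = begin
    suc k ^ suc k * excess k j b m
      ≡⟨ trans (cong (suc k ^ suc k *_) (excess-Bin k j b m)) (sym (Bin-*ˡ (suc k ^ suc k) m _)) ⟩
    Bin m (λ s t → suc k ^ suc k * (luckyWords k s * ((s ∸ j) * b ^ t)))
      ≡⟨ Bin-cong m (λ s t _ → term s t) ⟩
    Bin m (λ s t → h * ((s ∸ j) * (suc k ^ s * b ^ t)))
      ≡⟨ Bin-*ˡ h m _ ⟩
    h * surplus j (suc k) b m ∎
    where
    h : ℕ
    h = luckyWords k (suc k)
    regroup : ∀ D p h x y → D * (p * h * (x * y)) ≡ h * (x * (p * D * y))
    regroup = solve-∀
    term : ∀ s t → suc k ^ suc k * (luckyWords k s * ((s ∸ j) * b ^ t)) ≡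
                   h * ((s ∸ j) * (suc k ^ s * b ^ t))
    term s t with s ≤? j
    ... | yes s≤j rewrite m≤n⇒m∸n≡0 s≤j | *-zeroʳ (luckyWords k s) | *-zeroʳ h = *-zeroʳ (suc k ^ suc k)
    ... | no  s≰j = begin
      suc k ^ suc k * (luckyWords k s * ((s ∸ j) * b ^ t))
        ≡⟨ cong (λ x → suc k ^ suc k * (luckyWords k x * ((s ∸ j) * b ^ t))) s≡ ⟨
      suc k ^ suc k * (luckyWords k (i + suc k) * ((s ∸ j) * b ^ t))
        ≡⟨ cong (λ x → suc k ^ suc k * (x * ((s ∸ j) * b ^ t))) (luckyWords-^ k i) ⟩
      suc k ^ suc k * (suc k ^ i * h * ((s ∸ j) * b ^ t))
        ≡⟨ regroup (suc k ^ suc k) (suc k ^ i) h (s ∸ j) (b ^ t) ⟩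
      h * ((s ∸ j) * (suc k ^ i * suc k ^ suc k * b ^ t))
        ≡⟨ cong (λ x → h * ((s ∸ j) * (x * b ^ t)))
             (trans (sym (^-distribˡ-+-* (suc k) i (suc k))) (cong (suc k ^_) s≡)) ⟩
      h * ((s ∸ j) * (suc k ^ s * b ^ t)) ∎
      where
      i : ℕ
      i = s ∸ suc k
      s≡ : i + suc k ≡ s
      s≡ = m∸n+n≡m (≤-trans (s≤s k≤j) (≰⇒> s≰j))

  ∸-balance : ∀ s j → (s ∸ j) + j ≡ s + (j ∸ s)
  ∸-balance zero    zero    = refl
  ∸-balance zero    (suc j) = refl
  ∸-balance (suc s) zero    = refl
  ∸-balance (suc s) (suc j) = trans (+-suc (s ∸ j) j) (cong suc (∸-balance s j))

  surplus-deficit : ∀ j a b m → surplus j a b m + j * (a + b) ^ m ≡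
                    Bin m (λ s t → s * (a ^ s * b ^ t)) + deficit j a b m
  surplus-deficit j a b m = begin
    surplus j a b m + j * (a + b) ^ m
      ≡⟨ cong (λ x → surplus j a b m + j * x) (Bin-^ a b m) ⟨
    surplus j a b m + j * Bin m (λ s t → a ^ s * b ^ t)
      ≡⟨ cong (surplus j a b m +_) (Bin-*ˡ j m _) ⟨
    surplus j a b m + Bin m (λ s t → j * (a ^ s * b ^ t))
      ≡⟨ Bin-+ m _ _ ⟨
    Bin m (λ s t → (s ∸ j) * (a ^ s * b ^ t) + j * (a ^ s * b ^ t))
      ≡⟨ Bin-cong m (λ s t _ → balance s (a ^ s * b ^ t)) ⟩
    Bin m (λ s t → s * (a ^ s * b ^ t) + (j ∸ s) * (a ^ s * b ^ t))
      ≡⟨ trans (Bin-+ m _ _) (cong (Bin m (λ s t → s * (a ^ s * b ^ t)) +_) (sym (deficit-Bin j a b m))) ⟩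
    Bin m (λ s t → s * (a ^ s * b ^ t)) + deficit j a b m ∎
    where
    balance : ∀ s x → (s ∸ j) * x + j * x ≡ s * x + (j ∸ s) * x
    balance s x = begin
      (s ∸ j) * x + j * x ≡⟨ *-distribʳ-+ x (s ∸ j) j ⟨
      (s ∸ j + j) * x     ≡⟨ cong (_* x) (∸-balance s j) ⟩
      (s + (j ∸ s)) * x   ≡⟨ *-distribʳ-+ x s (j ∸ s) ⟩
      s * x + (j ∸ s) * x ∎

  -- The mean m a / (a + b) of s equals the threshold a when m = a + b, so surplus and deficit
  -- balance.
  surplus-diagonal : ∀ a M → let b = suc M in surplus a a b (a + b) ≡ deficit a a b (a + b)
  surplus-diagonal a M = +-cancelʳ-≡ (a * m ^ m) _ _ (begin
    surplus a a b m + a * m ^ m ≡⟨ surplus-deficit a a b m ⟩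
    S + deficit a a b m         ≡⟨ cong (_+ deficit a a b m) S≡ ⟩
    a * m ^ m + deficit a a b m ≡⟨ +-comm (a * m ^ m) _ ⟩
    deficit a a b m + a * m ^ m ∎)
    where
    b m S : ℕ
    b = suc M
    m = a + b
    S = Bin m (λ s t → s * (a ^ s * b ^ t))
    instance
      m≢0 : NonZero m
      m≢0 = m+n≢0
        where
        m+n≢0 : NonZero (a + suc M)
        m+n≢0 = subst NonZero (sym (+-suc a M)) _
    S≡ : S ≡ a * m ^ m
    S≡ = *-cancelˡ-≡ S (a * m ^ m) m (trans (Bin-s^ a b m) (*-assoc m a (m ^ m)))

  -- The binomial part has the coefficient n (k+1) - k (n+1) = n - k = b. This is the source of the
  -- term (n+1)^(n-1) in the theorem.
  surplus-next : ∀ k M → let b = suc M ; n = k + b in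
    surplus k (suc k) b n ≡ b * suc n ^ (n ∸ 1) + deficit k (suc k) b n
  surplus-next k M = +-cancelʳ-≡ (k * suc n ^ n) _ _ (begin
    surplus k (suc k) b n + k * suc n ^ n
      ≡⟨ surplus-deficit k (suc k) b n ⟩
    S + deficit k (suc k) b n
      ≡⟨ cong (_+ deficit k (suc k) b n) S≡ ⟩
    n * suc k * y + deficit k (suc k) b n
      ≡⟨ identity k b y (deficit k (suc k) b n) ⟩
    b * y + deficit k (suc k) b n + k * (suc n * y)
      ≡⟨ cong (λ x → b * y + deficit k (suc k) b n + k * x) power ⟨
    b * y + deficit k (suc k) b n + k * suc n ^ n ∎)
    where
    b n y S : ℕ
    b = suc M
    n = k + b
    y = suc n ^ (n ∸ 1)
    S = Bin n (λ s t → s * (suc k ^ s * b ^ t))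
    power : suc n ^ n ≡ suc n * y
    power = cong (suc n ^_) (sym (m+[n∸m]≡n (≤-trans (s≤s z≤n) (m≤n+m b k))))
    identity : ∀ k b y d → (k + b) * suc k * y + d ≡ b * y + d + k * (suc (k + b) * y)
    identity = solve-∀
    regroup : ∀ n k x y → n * k * (x * y) ≡ x * (n * k * y)
    regroup = solve-∀
    S≡ : S ≡ n * suc k * y
    S≡ = *-cancelˡ-≡ S _ (suc n) (begin
      suc n * S                 ≡⟨ Bin-s^ (suc k) b n ⟩
      n * suc k * suc n ^ n     ≡⟨ cong (n * suc k *_) power ⟩
      n * suc k * (suc n * y)   ≡⟨ regroup n (suc k) (suc n) y ⟩
      suc n * (n * suc k * y)   ∎)

  -- Closed forms of the deficits

  opaque

    unfolding deficit

    -- Conditioning on the first position: if it is counted by s, one unit of the threshold is used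
    -- up.
    deficit-suc : ∀ j a b m → deficit (suc j) a b (suc m) ≡ a * deficit j a b m + b * deficit (suc j) a b m
    deficit-suc j a b m = cong₂ _+_
      (trans (Bin-cong m λ s t _ → swap₁ (j ∸ s) a (a ^ s) (b ^ t)) (Bin-*ˡ a m _))
      (trans (Bin-cong m λ s t _ → swap₂ (suc j ∸ s) (a ^ s) b (b ^ t)) (Bin-*ˡ b m _))
      where
      swap₁ : ∀ d a x y → d * (a * x * y) ≡ a * (d * (x * y))
      swap₁ = solve-∀
      swap₂ : ∀ d x b y → d * (x * (b * y)) ≡ b * (d * (x * y))
      swap₂ = solve-∀

    deficit-0 : ∀ a b m → deficit 0 a b m ≡ 0
    deficit-0 a b m = Bin-zero m λ s t _ → cong (_* (a ^ s * b ^ t)) (0∸n≡0 s)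

    deficit-1 : ∀ a b m → deficit 1 a b m ≡ b ^ m
    deficit-1 a b zero    = refl
    deficit-1 a b (suc m) = begin
      deficit 1 a b (suc m)                     ≡⟨ deficit-suc 0 a b m ⟩
      a * deficit 0 a b m + b * deficit 1 a b m ≡⟨ cong₂ (λ x y → a * x + b * y) (deficit-0 a b m) (deficit-1 a b m) ⟩
      a * 0 + b * b ^ m                         ≡⟨ cong (_+ b * b ^ m) (*-zeroʳ a) ⟩
      b ^ suc m                                 ∎

    deficit-2 : ∀ a b i → deficit 2 a b (1 + i) ≡ (2 * b + (1 + i) * a) * b ^ i
    deficit-2 a b zero = base a b
      where
      base : ∀ a b → 1 * (a * 1 * 1) + 2 * (1 * (b * 1)) ≡ (2 * b + 1 * a) * 1
      base = solve-∀
    deficit-2 a b (suc i) = begin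
      deficit 2 a b (2 + i)
        ≡⟨ deficit-suc 1 a b (1 + i) ⟩
      a * deficit 1 a b (1 + i) + b * deficit 2 a b (1 + i)
        ≡⟨ cong₂ (λ x y → a * x + b * y) (deficit-1 a b (1 + i)) (deficit-2 a b i) ⟩
      a * (b * b ^ i) + b * ((2 * b + (1 + i) * a) * b ^ i)
        ≡⟨ step a b i (b ^ i) ⟩
      (2 * b + (2 + i) * a) * b ^ suc i ∎
      where
      step : ∀ a b i x → a * (b * x) + b * ((2 * b + (1 + i) * a) * x) ≡ (2 * b + (2 + i) * a) * (b * x)
      step = solve-∀

    -- Only s = 0, 1, 2 contribute. The factor 2 clears the denominator of the binomial coefficient
    -- for s = 2, and with m = 2 + i the lowest power of b is b^i. In `deficit-4` the factor 6 does
    -- the same for s = 3.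
    deficit-3 : ∀ a b i → 2 * deficit 3 a b (2 + i) ≡
      (6 * (b * b) + 4 * (2 + i) * (a * b) + (2 + i) * (1 + i) * (a * a)) * b ^ i
    deficit-3 a b zero = base a b
      where
      base : ∀ a b → 2 * ((1 * (a * (a * 1) * 1) + 2 * (a * 1 * (b * 1))) + (2 * (a * 1 * (b * 1)) + 3 * (1 * (b * (b * 1))))) ≡
             (6 * (b * b) + 8 * (a * b) + 2 * (a * a)) * 1
      base = solve-∀
    deficit-3 a b (suc i) = begin
      2 * deficit 3 a b (3 + i)
        ≡⟨ cong (2 *_) (deficit-suc 2 a b (2 + i)) ⟩
      2 * (a * deficit 2 a b (2 + i) + b * deficit 3 a b (2 + i))
        ≡⟨ distrib a b (deficit 2 a b (2 + i)) (deficit 3 a b (2 + i)) ⟩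
      2 * a * deficit 2 a b (2 + i) + b * (2 * deficit 3 a b (2 + i))
        ≡⟨ cong₂ (λ x y → 2 * a * x + b * y) (deficit-2 a b (1 + i)) (deficit-3 a b i) ⟩
      2 * a * ((2 * b + (2 + i) * a) * (b * b ^ i)) +
        b * ((6 * (b * b) + 4 * (2 + i) * (a * b) + (2 + i) * (1 + i) * (a * a)) * b ^ i)
        ≡⟨ step a b i (b ^ i) ⟩
      (6 * (b * b) + 4 * (3 + i) * (a * b) + (3 + i) * (2 + i) * (a * a)) * b ^ suc i ∎
      where
      distrib : ∀ a b x y → 2 * (a * x + b * y) ≡ 2 * a * x + b * (2 * y)
      distrib = solve-∀
      step : ∀ a b i x →
        2 * a * ((2 * b + (2 + i) * a) * (b * x)) +
        b * ((6 * (b * b) + 4 * (2 + i) * (a * b) + (2 + i) * (1 + i) * (a * a)) * x) ≡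
        (6 * (b * b) + 4 * (3 + i) * (a * b) + (3 + i) * (2 + i) * (a * a)) * (b * x)
      step = solve-∀

    deficit-4 : ∀ a b i → 6 * deficit 4 a b (3 + i) ≡
      (24 * (b * b * b) + 18 * (3 + i) * (a * b * b) + 6 * ((3 + i) * (2 + i)) * (a * a * b)
        + (3 + i) * (2 + i) * (1 + i) * (a * a * a)) * b ^ i
    deficit-4 a b zero = base a b
      where
      base : ∀ a b →
        6 * (((1 * (a * (a * (a * 1)) * 1) + 2 * (a * (a * 1) * (b * 1))) +
              (2 * (a * (a * 1) * (b * 1)) + 3 * (a * 1 * (b * (b * 1))))) +
             ((2 * (a * (a * 1) * (b * 1)) + 3 * (a * 1 * (b * (b * 1)))) +
              (3 * (a * 1 * (b * (b * 1))) + 4 * (1 * (b * (b * (b * 1))))))) ≡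
        (24 * (b * b * b) + 54 * (a * b * b) + 36 * (a * a * b) + 6 * (a * a * a)) * 1
      base = solve-∀
    deficit-4 a b (suc i) = begin
      6 * deficit 4 a b (4 + i)
        ≡⟨ cong (6 *_) (deficit-suc 3 a b (3 + i)) ⟩
      6 * (a * deficit 3 a b (3 + i) + b * deficit 4 a b (3 + i))
        ≡⟨ distrib a b (deficit 3 a b (3 + i)) (deficit 4 a b (3 + i)) ⟩
      3 * a * (2 * deficit 3 a b (3 + i)) + b * (6 * deficit 4 a b (3 + i))
        ≡⟨ cong₂ (λ x y → 3 * a * x + b * y) (deficit-3 a b (1 + i)) (deficit-4 a b i) ⟩
      3 * a * ((6 * (b * b) + 4 * (3 + i) * (a * b) + (3 + i) * (2 + i) * (a * a)) * (b * b ^ i)) +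
        b * ((24 * (b * b * b) + 18 * (3 + i) * (a * b * b) + 6 * ((3 + i) * (2 + i)) * (a * a * b)
          + (3 + i) * (2 + i) * (1 + i) * (a * a * a)) * b ^ i)
        ≡⟨ step a b i (b ^ i) ⟩
      (24 * (b * b * b) + 18 * (4 + i) * (a * b * b) + 6 * ((4 + i) * (3 + i)) * (a * a * b)
        + (4 + i) * (3 + i) * (2 + i) * (a * a * a)) * b ^ suc i ∎
      where
      distrib : ∀ a b x y → 6 * (a * x + b * y) ≡ 3 * a * (2 * x) + b * (6 * y)
      distrib = solve-∀
      step : ∀ a b i x →
        3 * a * ((6 * (b * b) + 4 * (3 + i) * (a * b) + (3 + i) * (2 + i) * (a * a)) * (b * x)) +
        b * ((24 * (b * b * b) + 18 * (3 + i) * (a * b * b) + 6 * ((3 + i) * (2 + i)) * (a * a * b)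
          + (3 + i) * (2 + i) * (1 + i) * (a * a * a)) * x) ≡
        (24 * (b * b * b) + 18 * (4 + i) * (a * b * b) + 6 * ((4 + i) * (3 + i)) * (a * a * b)
          + (4 + i) * (3 + i) * (2 + i) * (a * a * a)) * (b * x)
      step = solve-∀

  -- The third, fourth and fifth spots

  nC2 : ∀ r → 2 * ((2 + r) C 2) ≡ (2 + r) * (1 + r)
  nC2 zero    = refl
  nC2 (suc r) = begin
    2 * ((3 + r) C 2)                   ≡⟨ cong (2 *_) (nCk+nC[k+1]≡[n+1]C[k+1] (2 + r) 1) ⟨
    2 * ((2 + r) C 1 + (2 + r) C 2)     ≡⟨ *-distribˡ-+ 2 ((2 + r) C 1) _ ⟩
    2 * ((2 + r) C 1) + 2 * ((2 + r) C 2) ≡⟨ cong₂ (λ x y → 2 * x + y) (nC1≡n (2 + r)) (nC2 r) ⟩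
    2 * (2 + r) + (2 + r) * (1 + r)     ≡⟨ identity r ⟩
    (3 + r) * (2 + r)                   ∎
    where
    identity : ∀ r → 2 * (2 + r) + (2 + r) * (1 + r) ≡ (3 + r) * (2 + r)
    identity = solve-∀

  nC3 : ∀ r → 6 * ((3 + r) C 3) ≡ (3 + r) * (2 + r) * (1 + r)
  nC3 zero    = refl
  nC3 (suc r) = begin
    6 * ((4 + r) C 3)                   ≡⟨ cong (6 *_) (nCk+nC[k+1]≡[n+1]C[k+1] (3 + r) 2) ⟨
    6 * ((3 + r) C 2 + (3 + r) C 3)     ≡⟨ distrib ((3 + r) C 2) ((3 + r) C 3) ⟩
    3 * (2 * ((3 + r) C 2)) + 6 * ((3 + r) C 3) ≡⟨ cong₂ (λ x y → 3 * x + y) (nC2 (1 + r)) (nC3 r) ⟩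
    3 * ((3 + r) * (2 + r)) + (3 + r) * (2 + r) * (1 + r) ≡⟨ identity r ⟩
    (4 + r) * (3 + r) * (2 + r)         ∎
    where
    distrib : ∀ x y → 6 * (x + y) ≡ 3 * (2 * x) + 6 * y
    distrib = solve-∀
    identity : ∀ r → 3 * ((3 + r) * (2 + r)) + (3 + r) * (2 + r) * (1 + r) ≡ (4 + r) * (3 + r) * (2 + r)
    identity = solve-∀

  -- Here and in `excess-next`, D and h are passed as numerals, so that both equations are settled
  -- by computation; the second one enumerates all words of length k + 1.
  excess-diagonal : ∀ k M D h → D ≡ suc k ^ suc k → luckyWords k (suc k) ≡ h → let b = suc M in
    D * excess k (suc k) b (suc k + b) ≡ h * deficit (suc k) (suc k) b (suc k + b)
  excess-diagonal k M _ _ refl refl = trans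
    (excess-surplus k (suc k) (suc M) (suc k + suc M) (n≤1+n k))
    (cong (luckyWords k (suc k) *_) (surplus-diagonal (suc k) M))

  excess-next : ∀ k M D h → D ≡ suc k ^ suc k → luckyWords k (suc k) ≡ h → let b = suc M ; n = k + b in
    D * excess k k b n ≡ h * (b * suc n ^ (n ∸ 1) + deficit k (suc k) b n)
  excess-next k M _ _ refl refl = trans
    (excess-surplus k k (suc M) (k + suc M) ≤-refl)
    (cong (luckyWords k (suc k) *_) (surplus-next k M))

  -- Reduces h / D to lowest terms: 18/27, 160/256 and 1875/3125 become 2/3, 5/8 and 3/5, the
  -- leading coefficients of the three formulas.
  *-cancel-common : ∀ c p q {D h} x y .{{_ : NonZero c}} → D ≡ c * p → h ≡ c * q →
                    D * x ≡ h * y → p * x ≡ q * y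
  *-cancel-common c p q x y refl refl eq = *-cancelˡ-≡ (p * x) (q * y) c
    (trans (sym (*-assoc c p x)) (trans eq (*-assoc c q y)))

  excess-0 : ∀ M → let b = suc M in excess 0 1 b (1 + b) ≡ b * b ^ b
  excess-0 M = begin
    excess 0 1 b (1 + b)       ≡⟨ *-identityˡ _ ⟨
    1 * excess 0 1 b (1 + b)   ≡⟨ excess-diagonal 0 M 1 1 refl refl ⟩
    1 * deficit 1 1 b (1 + b)  ≡⟨ *-identityˡ _ ⟩
    deficit 1 1 b (1 + b)      ≡⟨ deficit-1 1 b (1 + b) ⟩
    b * b ^ b                  ∎
    where
    b : ℕ
    b = suc M

  -- As the threshold is the mean, the deficit is half of an unnormalised binomial mean absolute
  -- deviation. De Moivre's one-term formula for the latter explains why the polynomials here and in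
  -- `excess-2` and `excess-3` split into the factors b + 1, b + 2, b + 3.
  excess-1 : ∀ M → let b = suc M in excess 1 2 b (2 + b) ≡ 3 * (b + 1) * (b * b ^ b)
  excess-1 M = *-cancelˡ-≡ _ _ 4 (begin
    4 * excess 1 2 b (2 + b)
      ≡⟨ excess-diagonal 1 M 4 3 refl refl ⟩
    3 * deficit 2 2 b (2 + b)
      ≡⟨ cong (3 *_) (deficit-2 2 b (1 + b)) ⟩
    3 * ((2 * b + (1 + (1 + b)) * 2) * (b * b ^ b))
      ≡⟨ identity b (b * b ^ b) ⟩
    4 * (3 * (b + 1) * (b * b ^ b)) ∎)
    where
    b : ℕ
    b = suc M
    identity : ∀ b x → 3 * ((2 * b + (1 + (1 + b)) * 2) * x) ≡ 4 * (3 * (b + 1) * x)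
    identity = solve-∀

  excess-2 : ∀ M → let b = suc M in excess 2 3 b (3 + b) ≡ 9 * ((b + 1) * (b + 2)) * (b * b ^ b)
  excess-2 M = *-cancelˡ-≡ _ _ 3 (begin
    3 * excess 2 3 b (3 + b)
      ≡⟨ *-cancel-common 9 3 2 (excess 2 3 b (3 + b)) (deficit 3 3 b (3 + b)) refl refl (excess-diagonal 2 M 27 18 refl refl) ⟩
    2 * deficit 3 3 b (3 + b)
      ≡⟨ deficit-3 3 b (1 + b) ⟩
    (6 * (b * b) + 4 * (2 + (1 + b)) * (3 * b) + (2 + (1 + b)) * (1 + (1 + b)) * (3 * 3)) * (b * b ^ b)
      ≡⟨ identity b (b * b ^ b) ⟩
    3 * (9 * ((b + 1) * (b + 2)) * (b * b ^ b)) ∎)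
    where
    b : ℕ
    b = suc M
    identity : ∀ b x →
      (6 * (b * b) + 4 * (2 + (1 + b)) * (3 * b) + (2 + (1 + b)) * (1 + (1 + b)) * (3 * 3)) * x ≡
      3 * (9 * ((b + 1) * (b + 2)) * x)
    identity = solve-∀

  excess-3 : ∀ M → let b = suc M in
    3 * excess 3 4 b (4 + b) ≡ 80 * ((b + 1) * (b + 2) * (b + 3)) * (b * b ^ b)
  excess-3 M = scale b (excess 3 4 b (4 + b)) (deficit 4 4 b (4 + b)) (b * b ^ b)
    (*-cancel-common 32 8 5 (excess 3 4 b (4 + b)) (deficit 4 4 b (4 + b)) refl refl (excess-diagonal 3 M 256 160 refl refl))
    (deficit-4 4 b (1 + b))
    where
    b : ℕ
    b = suc M
    regroup : ∀ x → 16 * (3 * x) ≡ 6 * (8 * x)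
    regroup = solve-∀
    swap : ∀ x → 6 * (5 * x) ≡ 5 * (6 * x)
    swap = solve-∀
    -- The long bracket equals 256 (b+1)(b+2)(b+3), and 5 * 256 = 16 * 80.
    identity : ∀ b x →
      5 * ((24 * (b * b * b) + 18 * (3 + (1 + b)) * (4 * b * b) + 6 * ((3 + (1 + b)) * (2 + (1 + b))) * (4 * 4 * b)
        + (3 + (1 + b)) * (2 + (1 + b)) * (1 + (1 + b)) * (4 * 4 * 4)) * x) ≡
      16 * (80 * ((b + 1) * (b + 2) * (b + 3)) * x)
    identity = solve-∀
    scale : ∀ b e d x → 8 * e ≡ 5 * d →
      6 * d ≡ (24 * (b * b * b) + 18 * (3 + (1 + b)) * (4 * b * b) + 6 * ((3 + (1 + b)) * (2 + (1 + b))) * (4 * 4 * b)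
        + (3 + (1 + b)) * (2 + (1 + b)) * (1 + (1 + b)) * (4 * 4 * 4)) * x →
      3 * e ≡ 80 * ((b + 1) * (b + 2) * (b + 3)) * x
    scale b e d x eq₁ eq₂ = *-cancelˡ-≡ (3 * e) _ 16 (begin
      16 * (3 * e)  ≡⟨ regroup e ⟩
      6 * (8 * e)   ≡⟨ cong (6 *_) eq₁ ⟩
      6 * (5 * d)   ≡⟨ swap d ⟩
      5 * (6 * d)   ≡⟨ trans (cong (5 *_) eq₂) (identity b x) ⟩
      16 * (80 * ((b + 1) * (b + 2) * (b + 3)) * x) ∎)

  -- Solves `lucky-recurrence` for the total: every other term in it is a multiple of b, so the
  -- factor b cancels. The next two lemmas proceed alike.
  luckyTotal₃ : ∀ M → let b = suc M ; n = 2 + b in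
    3 * luckyTotal 2 n + (2 * b + 3) * b ^ b ≡ 2 * suc n ^ (n ∸ 1)
  luckyTotal₃ M = combine b (luckyTotal 2 n) (b ^ b) (suc n ^ (n ∸ 1)) (excess 2 2 b n) (deficit 2 3 b n)
    (n C 1) (excess 1 2 b n) (excess 0 1 b (1 + b))
    (lucky-recurrence 2 M) (nC1≡n n) (excess-1 M) (excess-0 M)
    (*-cancel-common 9 3 2 (excess 2 2 b n) (b * suc n ^ (n ∸ 1) + deficit 2 3 b n) refl refl (excess-next 2 M 27 18 refl refl)) (deficit-2 3 b (1 + b))
    where
    b n : ℕ
    b = suc M
    n = 2 + b
    -- `(10 * b + 12) * (b * B)` is twice the deficit in `excess 2 2 b n`. Adding it on the left
    -- avoids a subtraction, and it cancels against the same term from `expand`.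
    gather : ∀ b L B → b * (3 * L + (2 * b + 3) * B) + (10 * b + 12) * (b * B) ≡
      3 * (b * L + (1 * (1 * (3 * (b + 1) * (b * B))) + ((2 + b) * (1 * (b * B)) + 0)))
    gather = solve-∀
    expand : ∀ b P x → 2 * (b * P + (2 * b + (1 + (1 + b)) * 3) * x) ≡ b * (2 * P) + (10 * b + 12) * x
    expand = solve-∀
    combine : ∀ b L B P X D c Y₁ Y₀ .{{_ : NonZero b}} →
      b * L + (1 * (1 * Y₁) + (c * (1 * Y₀) + 0)) ≡ X → c ≡ 2 + b →
      Y₁ ≡ 3 * (b + 1) * (b * B) → Y₀ ≡ b * B →
      3 * X ≡ 2 * (b * P + D) → D ≡ (2 * b + (1 + (1 + b)) * 3) * (b * B) →
      3 * L + (2 * b + 3) * B ≡ 2 * P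
    combine b L B P X D c Y₁ Y₀ refl refl refl refl X≡ refl =
      *-cancelˡ-≡ _ _ b (+-cancelʳ-≡ ((10 * b + 12) * (b * B)) _ _
        (trans (gather b L B) (trans X≡ (expand b P (b * B)))))

  luckyTotal₄ : ∀ M → let b = suc M ; n = 3 + b in
    8 * luckyTotal 3 n + (13 * (b * b) + 52 * b + 48) * b ^ b ≡ 5 * suc n ^ (n ∸ 1)
  luckyTotal₄ M = combine b (luckyTotal 3 n) (b ^ b) (suc n ^ (n ∸ 1)) (excess 3 3 b n) (deficit 3 4 b n)
    (n C 1) (n C 2) (excess 2 3 b n) (excess 1 2 b (2 + b)) (excess 0 1 b (1 + b))
    (lucky-recurrence 3 M) (nC1≡n n) (nC2 (1 + b)) (excess-2 M) (excess-1 M) (excess-0 M)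
    (*-cancel-common 32 8 5 (excess 3 3 b n) (b * suc n ^ (n ∸ 1) + deficit 3 4 b n) refl refl (excess-next 3 M 256 160 refl refl)) (deficit-3 4 b (1 + b))
    where
    b n : ℕ
    b = suc M
    n = 3 + b
    Q : ℕ → ℕ
    Q b = 6 * (b * b) + 4 * (2 + (1 + b)) * (4 * b) + (2 + (1 + b)) * (1 + (1 + b)) * (4 * 4)
    gather : ∀ b L B → b * (2 * (8 * L + (13 * (b * b) + 52 * b + 48) * B)) +
        5 * ((6 * (b * b) + 4 * (2 + (1 + b)) * (4 * b) + (2 + (1 + b)) * (1 + (1 + b)) * (4 * 4)) * (b * B)) ≡
      16 * (b * L + 9 * ((b + 1) * (b + 2)) * (b * B) + (3 + b) * (3 * (b + 1) * (b * B)))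
        + 24 * ((2 + (1 + b)) * (1 + (1 + b))) * (b * B)
    gather = solve-∀
    -- The recurrence is multiplied by 2 * 8: the 8 belongs to the ratio 5/8, the 2 to `nC2` and
    -- `deficit-3`.
    regroup : ∀ l y₂ y₁ c y₀ → 16 * (l + y₂ + y₁) + 24 * (2 * c) * y₀ ≡
      2 * (8 * (l + (1 * (1 * y₂) + (y₁ + (c * (3 * y₀) + 0)))))
    regroup = solve-∀
    expand : ∀ b P D → 2 * (5 * (b * P + D)) ≡ b * (2 * (5 * P)) + 5 * (2 * D)
    expand = solve-∀
    combine : ∀ b L B P X D c₁ c₂ Y₂ Y₁ Y₀ .{{_ : NonZero b}} →
      b * L + (1 * (1 * Y₂) + (c₁ * (1 * Y₁) + (c₂ * (3 * Y₀) + 0))) ≡ X →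
      c₁ ≡ 3 + b → 2 * c₂ ≡ (2 + (1 + b)) * (1 + (1 + b)) →
      Y₂ ≡ 9 * ((b + 1) * (b + 2)) * (b * B) → Y₁ ≡ 3 * (b + 1) * (b * B) → Y₀ ≡ b * B →
      8 * X ≡ 5 * (b * P + D) → 2 * D ≡ Q b * (b * B) →
      8 * L + (13 * (b * b) + 52 * b + 48) * B ≡ 5 * P
    combine b L B P X D _ c₂ Y₂ Y₁ Y₀ refl refl c₂≡ refl refl refl X≡ D≡ =
      *-cancelˡ-≡ _ _ 2 (*-cancelˡ-≡ _ _ b (+-cancelʳ-≡ (5 * (Q b * (b * B))) _ _ (begin
        b * (2 * (8 * L + (13 * (b * b) + 52 * b + 48) * B)) + 5 * (Q b * (b * B))
          ≡⟨ gather b L B ⟩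
        16 * (b * L + Y₂ + (3 + b) * Y₁) + 24 * ((2 + (1 + b)) * (1 + (1 + b))) * Y₀
          ≡⟨ cong₂ (λ y c → 16 * (b * L + Y₂ + (3 + b) * y) + 24 * c * Y₀) (*-identityˡ Y₁) c₂≡ ⟨
        16 * (b * L + Y₂ + (3 + b) * (1 * Y₁)) + 24 * (2 * c₂) * Y₀
          ≡⟨ regroup (b * L) Y₂ ((3 + b) * (1 * Y₁)) c₂ Y₀ ⟩
        2 * (8 * X)
          ≡⟨ trans (cong (2 *_) X≡) (expand b P D) ⟩
        b * (2 * (5 * P)) + 5 * (2 * D)
          ≡⟨ cong (λ x → b * (2 * (5 * P)) + 5 * x) D≡ ⟩
        b * (2 * (5 * P)) + 5 * (Q b * (b * B)) ∎)))

  luckyTotal₅ : ∀ M → let b = suc M ; n = 4 + b in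
    30 * luckyTotal 4 n + (118 * (b * b * b) + 885 * (b * b) + 2075 * b + 1500) * b ^ b ≡ 18 * suc n ^ (n ∸ 1)
  luckyTotal₅ M = combine b (luckyTotal 4 n) (b ^ b) (suc n ^ (n ∸ 1)) (excess 4 4 b n) (deficit 4 5 b n)
    (n C 1) (n C 2) (n C 3) (excess 3 4 b n) (excess 2 3 b (3 + b)) (excess 1 2 b (2 + b)) (excess 0 1 b (1 + b))
    (lucky-recurrence 4 M) (nC1≡n n) (nC2 (2 + b)) (nC3 (1 + b))
    (excess-3 M) (excess-2 M) (excess-1 M) (excess-0 M)
    (*-cancel-common 625 5 3 (excess 4 4 b n) (b * suc n ^ (n ∸ 1) + deficit 4 5 b n) refl refl (excess-next 4 M 3125 1875 refl refl)) (deficit-4 5 b (1 + b))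
    where
    b n : ℕ
    b = suc M
    n = 4 + b
    Q : ℕ → ℕ
    Q b = 24 * (b * b * b) + 18 * (3 + (1 + b)) * (5 * b * b) + 6 * ((3 + (1 + b)) * (2 + (1 + b))) * (5 * 5 * b)
      + (3 + (1 + b)) * (2 + (1 + b)) * (1 + (1 + b)) * (5 * 5 * 5)
    gather : ∀ b L B →
      b * (30 * L + (118 * (b * b * b) + 885 * (b * b) + 2075 * b + 1500) * B) +
        3 * ((24 * (b * b * b) + 18 * (3 + (1 + b)) * (5 * b * b) + 6 * ((3 + (1 + b)) * (2 + (1 + b))) * (5 * 5 * b)
          + (3 + (1 + b)) * (2 + (1 + b)) * (1 + (1 + b)) * (5 * 5 * 5)) * (b * B)) ≡
      30 * (b * L + (4 + b) * (9 * ((b + 1) * (b + 2)) * (b * B)))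
        + 10 * (80 * ((b + 1) * (b + 2) * (b + 3)) * (b * B))
        + 45 * ((2 + (2 + b)) * (1 + (2 + b))) * (3 * (b + 1) * (b * B))
        + 80 * ((3 + (1 + b)) * (2 + (1 + b)) * (1 + (1 + b))) * (b * B)
    gather = solve-∀
    -- The recurrence is multiplied by 6 * 5: the 5 belongs to the ratio 3/5, and the 6 clears the
    -- denominators in `excess-3`, `nC2`, `nC3` and `deficit-4`. The inner factors 1, 1, 3, 16 are
    -- the values of `gapWords e e`.
    regroup : ∀ l y₂ y₃ c₂ y₁ c₃ y₀ →
      30 * (l + y₂) + 10 * (3 * y₃) + 45 * (2 * c₂) * y₁ + 80 * (6 * c₃) * y₀ ≡
      6 * (5 * (l + (1 * (1 * y₃) + (y₂ + (c₂ * (3 * y₁) + (c₃ * (16 * y₀) + 0))))))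
    regroup = solve-∀
    expand : ∀ b P D → 6 * (3 * (b * P + D)) ≡ b * (18 * P) + 3 * (6 * D)
    expand = solve-∀
    combine : ∀ b L B P X D c₁ c₂ c₃ Y₃ Y₂ Y₁ Y₀ .{{_ : NonZero b}} →
      b * L + (1 * (1 * Y₃) + (c₁ * (1 * Y₂) + (c₂ * (3 * Y₁) + (c₃ * (16 * Y₀) + 0)))) ≡ X →
      c₁ ≡ 4 + b → 2 * c₂ ≡ (2 + (2 + b)) * (1 + (2 + b)) →
      6 * c₃ ≡ (3 + (1 + b)) * (2 + (1 + b)) * (1 + (1 + b)) →
      3 * Y₃ ≡ 80 * ((b + 1) * (b + 2) * (b + 3)) * (b * B) →
      Y₂ ≡ 9 * ((b + 1) * (b + 2)) * (b * B) → Y₁ ≡ 3 * (b + 1) * (b * B) → Y₀ ≡ b * B →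
      5 * X ≡ 3 * (b * P + D) → 6 * D ≡ Q b * (b * B) →
      30 * L + (118 * (b * b * b) + 885 * (b * b) + 2075 * b + 1500) * B ≡ 18 * P
    combine b L B P X D _ c₂ c₃ Y₃ Y₂ Y₁ Y₀ refl refl c₂≡ c₃≡ Y₃≡ refl refl refl X≡ D≡ =
      *-cancelˡ-≡ _ _ b (+-cancelʳ-≡ (3 * (Q b * (b * B))) _ _ (begin
        b * (30 * L + (118 * (b * b * b) + 885 * (b * b) + 2075 * b + 1500) * B) + 3 * (Q b * (b * B))
          ≡⟨ gather b L B ⟩
        30 * (b * L + (4 + b) * Y₂) + 10 * (80 * ((b + 1) * (b + 2) * (b + 3)) * (b * B))
          + 45 * ((2 + (2 + b)) * (1 + (2 + b))) * Y₁
          + 80 * ((3 + (1 + b)) * (2 + (1 + b)) * (1 + (1 + b))) * Y₀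
          ≡⟨ cong₂ _+_ (cong₂ _+_ (cong₂ (λ y z → 30 * (b * L + (4 + b) * y) + 10 * z) (*-identityˡ Y₂) Y₃≡)
               (cong (λ c → 45 * c * Y₁) c₂≡)) (cong (λ c → 80 * c * Y₀) c₃≡) ⟨
        30 * (b * L + (4 + b) * (1 * Y₂)) + 10 * (3 * Y₃) + 45 * (2 * c₂) * Y₁ + 80 * (6 * c₃) * Y₀
          ≡⟨ regroup (b * L) ((4 + b) * (1 * Y₂)) Y₃ c₂ Y₁ c₃ Y₀ ⟩
        6 * (5 * X)
          ≡⟨ trans (cong (6 *_) X≡) (expand b P D) ⟩
        b * (18 * P) + 3 * (6 * D)
          ≡⟨ cong (λ x → b * (18 * P) + 3 * x) D≡ ⟩
        b * (18 * P) + 3 * (Q b * (b * B)) ∎))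

-- The formulas over ℚ

open Counting using
  (luckyTotal; luckySpotCount≡sumOfQ; luckySpotCount-Σw; luckyTotal₃; luckyTotal₄; luckyTotal₅)
open import Data.Fin as Fin using (fromℕ<; _↑ʳ_)
open import Data.Integer as ℤ using (+_)
import Data.Integer.Properties as ℤ
open import Data.Nat using (ℕ; suc; s≤s; z≤n; _≤_; _∸_; _^_) renaming (_+_ to _+ℕ_; _*_ to _*ℕ_)
import Data.Nat.Properties as ℕ
open import Data.Nat.Tactic.RingSolver using (solve-∀)
open import Data.Product using (_×_; _,_)
open import Data.Rational using (ℚ; _+_; _*_; _-_; _/_; 1ℚ)
open import Data.Rational.Properties using (toℚᵘ-injective; toℚᵘ-homo-+; toℚᵘ-homo-*; *-assoc; *-identityˡ)
open import Data.Rational.Solver using (module +-*-Solver)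
import Data.Rational.Unnormalised as ℚᵘ
import Data.Rational.Unnormalised.Properties as ℚᵘ
open import Relation.Binary.PropositionalEquality using (_≡_; refl; sym; trans; cong; cong₂; module ≡-Reasoning)
open ≡-Reasoning

ι-+ : ∀ m n → ι (m +ℕ n) ≡ ι m + ι n
ι-+ m n = toℚᵘ-injective (ℚᵘ.≃-trans
  (ℚᵘ.*≡* (cong (ℤ._* ℤ.1ℤ) (sym (cong₂ ℤ._+_ (ℤ.*-identityʳ (+ m)) (ℤ.*-identityʳ (+ n))))))
  (ℚᵘ.≃-sym (toℚᵘ-homo-+ (ι m) (ι n))))

ι-* : ∀ m n → ι (m *ℕ n) ≡ ι m * ι n
ι-* m n = toℚᵘ-injective (ℚᵘ.≃-trans
  (ℚᵘ.*≡* (cong (ℤ._* ℤ.1ℤ) (ℤ.pos-* m n)))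
  (ℚᵘ.≃-sym (toℚᵘ-homo-* (ι m) (ι n))))

transpose : ∀ {x} u {y} → x + u ≡ y → x ≡ y - u
transpose {x} u refl = solve 2 (λ x u → x := x :+ u :- u) refl x u
  where open +-*-Solver

divide : ∀ (c⁻¹ d/c : ℚ) c d a {α} l B P →
  c⁻¹ * ι c ≡ 1ℚ → c⁻¹ * ι d ≡ d/c → ι a ≡ α →
  c *ℕ l +ℕ a *ℕ B ≡ d *ℕ P →
  ι l ≡ d/c * ι P - c⁻¹ * α * ι B
divide c⁻¹ _ c d a l B P c⁻¹c≡1 refl refl eq = begin
  ι l
    ≡⟨ *-identityˡ (ι l) ⟨
  1ℚ * ι l
    ≡⟨ cong (_* ι l) c⁻¹c≡1 ⟨
  c⁻¹ * ι c * ι l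
    ≡⟨ transpose (c⁻¹ * ι a * ι B) (expand c⁻¹ (ι c) (ι l) (ι a) (ι B)) ⟩
  c⁻¹ * (ι c * ι l + ι a * ι B) - c⁻¹ * ι a * ι B
    ≡⟨ cong (λ x → c⁻¹ * x - c⁻¹ * ι a * ι B) ιeq ⟩
  c⁻¹ * (ι d * ι P) - c⁻¹ * ι a * ι B
    ≡⟨ cong (_- c⁻¹ * ι a * ι B) (*-assoc c⁻¹ (ι d) (ι P)) ⟨
  c⁻¹ * ι d * ι P - c⁻¹ * ι a * ι B ∎
  where
  expand : ∀ r c l a B → r * c * l + r * a * B ≡ r * (c * l + a * B)
  expand = solve 5 (λ r c l a B → r :* c :* l :+ r :* a :* B := r :* (c :* l :+ a :* B)) refl
    where open +-*-Solver
  ιeq : ι c * ι l + ι a * ι B ≡ ι d * ι P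
  ιeq = begin
    ι c * ι l + ι a * ι B        ≡⟨ cong₂ _+_ (ι-* c l) (ι-* a B) ⟨
    ι (c *ℕ l) + ι (a *ℕ B)      ≡⟨ ι-+ (c *ℕ l) (a *ℕ B) ⟨
    ι (c *ℕ l +ℕ a *ℕ B)         ≡⟨ cong ι eq ⟩
    ι (d *ℕ P)                   ≡⟨ ι-* d P ⟩
    ι d * ι P                    ∎

-- In terms of b all coefficients are positive, which kept the count inside ℕ; the signs of the
-- theorem arise on returning to n = b + 2, and likewise to b + 3 and b + 4 below.
coefficient₃ : ∀ b → ι (2 *ℕ b +ℕ 3) ≡ ι 2 * ι (2 +ℕ b) - ι 1
coefficient₃ b = transpose (ι 1) (begin
  ι (2 *ℕ b +ℕ 3) + ι 1  ≡⟨ ι-+ (2 *ℕ b +ℕ 3) 1 ⟨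
  ι (2 *ℕ b +ℕ 3 +ℕ 1)   ≡⟨ cong ι (identity b) ⟩
  ι (2 *ℕ (2 +ℕ b))      ≡⟨ ι-* 2 (2 +ℕ b) ⟩
  ι 2 * ι (2 +ℕ b)       ∎)
  where
  identity : ∀ b → 2 *ℕ b +ℕ 3 +ℕ 1 ≡ 2 *ℕ (2 +ℕ b)
  identity = solve-∀

coefficient₄ : ∀ b → let n = 3 +ℕ b in
  ι (13 *ℕ (b *ℕ b) +ℕ 52 *ℕ b +ℕ 48) ≡ ι 13 * ι (n ^ 2) - ι 26 * ι n + ι 9
coefficient₄ b = begin
  ι p                                           ≡⟨ transpose (ι 26 * ι n) sum≡ ⟩
  ι 13 * ι (n ^ 2) + ι 9 - ι 26 * ι n           ≡⟨ swap (ι 13 * ι (n ^ 2)) (ι 9) (ι 26 * ι n) ⟩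
  ι 13 * ι (n ^ 2) - ι 26 * ι n + ι 9           ∎
  where
  n p : ℕ
  n = 3 +ℕ b
  p = 13 *ℕ (b *ℕ b) +ℕ 52 *ℕ b +ℕ 48
  swap : ∀ x y z → x + y - z ≡ x - z + y
  swap = solve 3 (λ x y z → x :+ y :- z := x :- z :+ y) refl
    where open +-*-Solver
  identity : ∀ b → 13 *ℕ (b *ℕ b) +ℕ 52 *ℕ b +ℕ 48 +ℕ 26 *ℕ (3 +ℕ b) ≡
    13 *ℕ ((3 +ℕ b) *ℕ ((3 +ℕ b) *ℕ 1)) +ℕ 9
  identity = solve-∀
  sum≡ : ι p + ι 26 * ι n ≡ ι 13 * ι (n ^ 2) + ι 9
  sum≡ = begin
    ι p + ι 26 * ι n           ≡⟨ cong (λ x → ι p + x) (ι-* 26 n) ⟨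
    ι p + ι (26 *ℕ n)          ≡⟨ ι-+ p (26 *ℕ n) ⟨
    ι (p +ℕ 26 *ℕ n)           ≡⟨ cong ι (identity b) ⟩
    ι (13 *ℕ n ^ 2 +ℕ 9)       ≡⟨ ι-+ (13 *ℕ n ^ 2) 9 ⟩
    ι (13 *ℕ n ^ 2) + ι 9      ≡⟨ cong (_+ ι 9) (ι-* 13 (n ^ 2)) ⟩
    ι 13 * ι (n ^ 2) + ι 9     ∎

coefficient₅ : ∀ b → let n = 4 +ℕ b in
  ι (118 *ℕ (b *ℕ b *ℕ b) +ℕ 885 *ℕ (b *ℕ b) +ℕ 2075 *ℕ b +ℕ 1500) ≡
  ι 118 * ι (n ^ 3) - ι 531 * ι (n ^ 2) + ι 659 * ι n - ι 192
coefficient₅ b = transpose (ι 192) (begin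
  ι p + ι 192
    ≡⟨ ι-+ p 192 ⟨
  ι (p +ℕ 192)
    ≡⟨ transpose (ι 531 * ι (n ^ 2)) sum≡ ⟩
  ι 118 * ι (n ^ 3) + ι 659 * ι n - ι 531 * ι (n ^ 2)
    ≡⟨ swap (ι 118 * ι (n ^ 3)) (ι 659 * ι n) (ι 531 * ι (n ^ 2)) ⟩
  ι 118 * ι (n ^ 3) - ι 531 * ι (n ^ 2) + ι 659 * ι n ∎)
  where
  n p : ℕ
  n = 4 +ℕ b
  p = 118 *ℕ (b *ℕ b *ℕ b) +ℕ 885 *ℕ (b *ℕ b) +ℕ 2075 *ℕ b +ℕ 1500
  swap : ∀ x y z → x + y - z ≡ x - z + y
  swap = solve 3 (λ x y z → x :+ y :- z := x :- z :+ y) refl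
    where open +-*-Solver
  identity : ∀ b → 118 *ℕ (b *ℕ b *ℕ b) +ℕ 885 *ℕ (b *ℕ b) +ℕ 2075 *ℕ b +ℕ 1500 +ℕ 192
      +ℕ 531 *ℕ ((4 +ℕ b) *ℕ ((4 +ℕ b) *ℕ 1)) ≡
    118 *ℕ ((4 +ℕ b) *ℕ ((4 +ℕ b) *ℕ ((4 +ℕ b) *ℕ 1))) +ℕ 659 *ℕ (4 +ℕ b)
  identity = solve-∀
  sum≡ : ι (p +ℕ 192) + ι 531 * ι (n ^ 2) ≡ ι 118 * ι (n ^ 3) + ι 659 * ι n
  sum≡ = begin
    ι (p +ℕ 192) + ι 531 * ι (n ^ 2)       ≡⟨ cong (λ x → ι (p +ℕ 192) + x) (ι-* 531 (n ^ 2)) ⟨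
    ι (p +ℕ 192) + ι (531 *ℕ n ^ 2)        ≡⟨ ι-+ (p +ℕ 192) (531 *ℕ n ^ 2) ⟨
    ι (p +ℕ 192 +ℕ 531 *ℕ n ^ 2)           ≡⟨ cong ι (identity b) ⟩
    ι (118 *ℕ n ^ 3 +ℕ 659 *ℕ n)           ≡⟨ ι-+ (118 *ℕ n ^ 3) (659 *ℕ n) ⟩
    ι (118 *ℕ n ^ 3) + ι (659 *ℕ n)        ≡⟨ cong₂ _+_ (ι-* 118 (n ^ 3)) (ι-* 659 n) ⟩
    ι 118 * ι (n ^ 3) + ι 659 * ι n        ∎

lucky-formula : ∀ k M (c⁻¹ d/c : ℚ) c d a {α} → let b = suc M ; n = k +ℕ b in
  c⁻¹ * ι c ≡ 1ℚ → c⁻¹ * ι d ≡ d/c → ι a ≡ α →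
  c *ℕ luckyTotal k n +ℕ a *ℕ b ^ b ≡ d *ℕ suc n ^ (n ∸ 1) →
  ι (sumOfQ n (k ↑ʳ Fin.zero)) ≡ d/c * ι ((n +ℕ 1) ^ (n ∸ 1)) - c⁻¹ * α * ι (b ^ b)
lucky-formula k M c⁻¹ d/c c d a {α} c⁻¹c≡1 c⁻¹d≡d/c a≡α eq = begin
  ι (sumOfQ n (k ↑ʳ Fin.zero))
    ≡⟨ cong ι (trans (sym (luckySpotCount≡sumOfQ n (k ↑ʳ Fin.zero))) (luckySpotCount-Σw k M)) ⟩
  ι (luckyTotal k n)
    ≡⟨ divide c⁻¹ d/c c d a (luckyTotal k n) (b ^ b) (suc n ^ (n ∸ 1)) c⁻¹c≡1 c⁻¹d≡d/c a≡α eq ⟩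
  d/c * ι (suc n ^ (n ∸ 1)) - c⁻¹ * α * ι (b ^ b)
    ≡⟨ cong (λ x → d/c * ι (x ^ (n ∸ 1)) - c⁻¹ * α * ι (b ^ b)) (ℕ.+-comm n 1) ⟨
  d/c * ι ((n +ℕ 1) ^ (n ∸ 1)) - c⁻¹ * α * ι (b ^ b) ∎
  where
  b n : ℕ
  b = suc M
  n = k +ℕ b

mainTheorem8 : (∀ n (h : 3 ≤ n) →
    luckySpotCount n (fromℕ< h) ≡ sumOfQ n (fromℕ< h) ×
    ι (sumOfQ n (fromℕ< h)) ≡
    (+ 2 / 3) * ι ((n +ℕ 1) ^ (n ∸ 1))
    - (+ 1 / 3) * (ι 2 * ι n - ι 1) * ι ((n ∸ 2) ^ (n ∸ 2))) ×
    (∀ n (h : 4 ≤ n) →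
    luckySpotCount n (fromℕ< h) ≡ sumOfQ n (fromℕ< h) ×
    ι (sumOfQ n (fromℕ< h)) ≡
    (+ 5 / 8) * ι ((n +ℕ 1) ^ (n ∸ 1))
    - (+ 1 / 8) * (ι 13 * ι (n ^ 2) - ι 26 * ι n + ι 9) * ι ((n ∸ 3) ^ (n ∸ 3))) ×
    (∀ n (h : 5 ≤ n) →
    luckySpotCount n (fromℕ< h) ≡ sumOfQ n (fromℕ< h) ×
    ι (sumOfQ n (fromℕ< h)) ≡
    (+ 3 / 5) * ι ((n +ℕ 1) ^ (n ∸ 1))
    - (+ 1 / 30) * (ι 118 * ι (n ^ 3) - ι 531 * ι (n ^ 2) + ι 659 * ι n - ι 192) * ι ((n ∸ 4) ^ (n ∸ 4)))
mainTheorem8 =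
  -- Matching on `h` makes n the sum of 2 and `suc M`, so that `fromℕ< h` computes to
  -- `2 ↑ʳ Fin.zero` and b = n - 2 is visibly positive.
  (λ { n h@(s≤s (s≤s (s≤s (z≤n {M})))) → luckySpotCount≡sumOfQ n (fromℕ< h) ,
    lucky-formula 2 M (+ 1 / 3) (+ 2 / 3) 3 2 (2 *ℕ suc M +ℕ 3)
      refl refl (coefficient₃ (suc M)) (luckyTotal₃ M) }) ,
  (λ { n h@(s≤s (s≤s (s≤s (s≤s (z≤n {M}))))) → luckySpotCount≡sumOfQ n (fromℕ< h) ,
    lucky-formula 3 M (+ 1 / 8) (+ 5 / 8) 8 5
      (13 *ℕ (suc M *ℕ suc M) +ℕ 52 *ℕ suc M +ℕ 48)
      refl refl (coefficient₄ (suc M)) (luckyTotal₄ M) }) ,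
  (λ { n h@(s≤s (s≤s (s≤s (s≤s (s≤s (z≤n {M})))))) → luckySpotCount≡sumOfQ n (fromℕ< h) ,
    lucky-formula 4 M (+ 1 / 30) (+ 3 / 5) 30 18
      (118 *ℕ (suc M *ℕ suc M *ℕ suc M) +ℕ 885 *ℕ (suc M *ℕ suc M) +ℕ 2075 *ℕ suc M +ℕ 1500)
      refl refl (coefficient₅ (suc M)) (luckyTotal₅ M) })
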